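{- There is at most one function $G$, holomorphic on $\mathbb{C}\setminus[1,\infty)$, with the following three properties: (a) for all $z\in\mathbb{C}\setminus[0,\infty)$, $$-\frac{1}{1-z}-\frac{1}{(1-z)^{2}}\,G\left(\frac{1}{1-z}\right)+2G(z+1)=G(z);$$ (b) for all $z\in\mathbb{C}\setminus[0,\infty)$, $$G(z+1)=-\frac{1}{z^{2}}\,G\left(\frac{1}{z}+1\right)-\frac{1}{z};$$ (c) $G(z)\to 0$ as $z\to\infty$ in such a way that the distance from $z$ to $\mathbb{R}_{+}=[0,\infty)$ tends to infinity. That is, if $G_1$ and $G_2$ are two such functions, then $G_1=G_2$. -}

module Defs where

open import Level using (0ℓ; suc)
open import Algebra.Bundles using (CommutativeRing)
import Algebra.Properties.Ring as RingProperties
open import Data.Product using (Σ; ∃; _×_; _,_; proj₁; proj₂; zip; map)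
open import Data.Sum using (inj₁; inj₂)
open import Function.Bundles using (_⟶ₛ_; _⟨$⟩_)
open import Relation.Binary.Bundles using (Setoid; Poset)
open import Relation.Binary.Core using (Rel)
open import Relation.Binary.Structures using (IsTotalOrder)
import Relation.Binary.Construct.NonStrictToStrict as ToStrict
import Relation.Binary.Reasoning.PartialOrder as PosetReasoning
open import Relation.Nullary using (¬_)
open import Relation.Unary using (Pred; _∈_; ∁; Satisfiable)

module _ {A : Set} (_≤_ : Rel A 0ℓ) where

  UpperBound : Pred A 0ℓ → Pred A 0ℓ
  UpperBound P b = ∀ {x} → x ∈ P → x ≤ b

  IsSupremum : Pred A 0ℓ → Pred A 0ℓ
  IsSupremum P s = UpperBound P s × (∀ {b} → b ∈ UpperBound P → s ≤ b)

-- The standard library has no real numbers.  They are described by their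
-- categorical axioms: classically, a Dedekind-complete ordered field is ℝ,
-- up to a unique isomorphism.  Equality is a setoid equality, so that the
-- usual constructions of ℝ (which are quotients) are instances.

record CompleteOrderedField : Set (suc 0ℓ) where
  infix  9 _⁻¹
  infix  4 _≤_
  field
    commutativeRing : CommutativeRing 0ℓ 0ℓ
  open CommutativeRing commutativeRing public
  field
    0≉1             : ¬ (0# ≈ 1#)
    -- Total, as is customary; the value at 0# is unconstrained.
    _⁻¹             : Carrier → Carrier
    ⁻¹-cong         : ∀ {x y} → x ≈ y → x ⁻¹ ≈ y ⁻¹
    ⁻¹-inverseʳ     : ∀ {x} → ¬ (x ≈ 0#) → x * x ⁻¹ ≈ 1#
    _≤_             : Rel Carrier 0ℓ
    isTotalOrder    : IsTotalOrder _≈_ _≤_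
    +-monoˡ-≤       : ∀ z {x y} → x ≤ y → x + z ≤ y + z
    *-nonNegative   : ∀ {x y} → 0# ≤ x → 0# ≤ y → 0# ≤ x * y
    supremum        : (P : Pred Carrier 0ℓ) → Satisfiable P →
                      Satisfiable (UpperBound _≤_ P) → ∃ (IsSupremum _≤_ P)

  module ≤ = IsTotalOrder isTotalOrder
  open ToStrict _≈_ _≤_ public using (_<_)

  poset : Poset 0ℓ 0ℓ 0ℓ
  poset = record { isPartialOrder = ≤.isPartialOrder }

  private
    module R = RingProperties ring
    open PosetReasoning poset

  +-mono-≤ : ∀ {w x y z} → w ≤ x → y ≤ z → w + y ≤ x + z
  +-mono-≤ {w} {x} {y} {z} w≤x y≤z = begin
    w + y  ≤⟨ +-monoˡ-≤ y w≤x ⟩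
    x + y  ≈⟨ +-comm x y ⟩
    y + x  ≤⟨ +-monoˡ-≤ x y≤z ⟩
    z + x  ≈⟨ +-comm z x ⟩
    x + z  ∎

  x≤y⇒0≤y-x : ∀ {x y} → x ≤ y → 0# ≤ y - x
  x≤y⇒0≤y-x {x} {y} x≤y = begin
    0#     ≈⟨ -‿inverseʳ x ⟨
    x - x  ≤⟨ +-monoˡ-≤ (- x) x≤y ⟩
    y - x  ∎

  0≤y-x⇒x≤y : ∀ {x y} → 0# ≤ y - x → x ≤ y
  0≤y-x⇒x≤y {x} {y} 0≤y-x = begin
    x            ≈⟨ +-identityˡ x ⟨
    0# + x       ≤⟨ +-monoˡ-≤ x 0≤y-x ⟩
    y - x + x    ≈⟨ +-assoc y (- x) x ⟩
    y + (- x + x) ≈⟨ +-congˡ (-‿inverseˡ x) ⟩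
    y + 0#       ≈⟨ +-identityʳ y ⟩
    y            ∎

  x≤0⇒0≤-x : ∀ {x} → x ≤ 0# → 0# ≤ - x
  x≤0⇒0≤-x {x} x≤0 = begin
    0#     ≤⟨ x≤y⇒0≤y-x x≤0 ⟩
    0# - x ≈⟨ +-identityˡ (- x) ⟩
    - x    ∎

  0≤x*x : ∀ x → 0# ≤ x * x
  0≤x*x x with ≤.total 0# x
  ... | inj₁ 0≤x = *-nonNegative 0≤x 0≤x
  ... | inj₂ x≤0 = begin
    0#           ≤⟨ *-nonNegative (x≤0⇒0≤-x x≤0) (x≤0⇒0≤-x x≤0) ⟩
    - x * - x    ≈⟨ R.-‿distribˡ-* x (- x) ⟨
    - (x * - x)  ≈⟨ -‿cong (R.-‿distribʳ-* x x) ⟨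
    - - (x * x)  ≈⟨ R.-‿involutive (x * x) ⟩
    x * x        ∎

  0≤1 : 0# ≤ 1#
  0≤1 = begin
    0#       ≤⟨ 0≤x*x 1# ⟩
    1# * 1#  ≈⟨ *-identityˡ 1# ⟩
    1#       ∎

  1≤x⇒x≤x*x : ∀ {x} → 1# ≤ x → x ≤ x * x
  1≤x⇒x≤x*x {x} 1≤x = 0≤y-x⇒x≤y (begin
    0#                ≤⟨ *-nonNegative (≤.trans 0≤1 1≤x) (x≤y⇒0≤y-x 1≤x) ⟩
    x * (x - 1#)      ≈⟨ distribˡ x x (- 1#) ⟩
    x * x + x * - 1#  ≈⟨ +-congˡ (R.-‿distribʳ-* x 1#) ⟨
    x * x - x * 1#    ≈⟨ +-congˡ (-‿cong (*-identityʳ x)) ⟩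
    x * x - x         ∎)

  x≤y+x : ∀ {x y} → 0# ≤ y → x ≤ y + x
  x≤y+x {x} {y} 0≤y = begin
    x       ≈⟨ +-identityˡ x ⟨
    0# + x  ≤⟨ +-monoˡ-≤ x 0≤y ⟩
    y + x   ∎

  sqrt-supremum : ∀ {x} → 0# ≤ x → ∃ (IsSupremum _≤_ (λ t → t * t ≤ x))
  sqrt-supremum {x} 0≤x = supremum _
    (0# , (begin 0# * 0# ≈⟨ zeroˡ 0# ⟩ 0# ≤⟨ 0≤x ⟩ x ∎))
    (x + 1# , bounded)
    where
    bounded : UpperBound _≤_ (λ t → t * t ≤ x) (x + 1#)
    bounded {t} t*t≤x with ≤.total t 1#
    ... | inj₁ t≤1 = ≤.trans t≤1 (x≤y+x 0≤x)
    ... | inj₂ 1≤t = begin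
      t       ≤⟨ 1≤x⇒x≤x*x 1≤t ⟩
      t * t   ≤⟨ t*t≤x ⟩
      x       ≤⟨ x≤y+x 0≤1 ⟩
      1# + x  ≈⟨ +-comm 1# x ⟩
      x + 1#  ∎

  sqrt : (x : Carrier) → 0# ≤ x → Carrier
  sqrt x 0≤x = proj₁ (sqrt-supremum 0≤x)

  0≤sqrt : ∀ {x} (0≤x : 0# ≤ x) → 0# ≤ sqrt x 0≤x
  0≤sqrt {x} 0≤x = proj₁ (proj₂ (sqrt-supremum 0≤x))
    (begin 0# * 0# ≈⟨ zeroˡ 0# ⟩ 0# ≤⟨ 0≤x ⟩ x ∎)

module ComplexNumbers (ℝ : CompleteOrderedField) where

  private
    module ℝ = CompleteOrderedField ℝ
  open ℝ using (0#; 1#; _≤_; _<_)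

  infix  9 _⁻¹ _²
  infixl 7 _*_
  infixl 6 _+_ _-_
  infix  8 -_
  infix  4 _≈_

  record ℂ : Set where
    constructor _+i_
    field
      re im : ℝ.Carrier
  open ℂ public

  _≈_ : Rel ℂ 0ℓ
  z ≈ w = (re z ℝ.≈ re w) × (im z ℝ.≈ im w)

  ℂ-setoid : Setoid 0ℓ 0ℓ
  ℂ-setoid = record
    { Carrier       = ℂ
    ; _≈_           = _≈_
    ; isEquivalence = record
      { refl  = ℝ.refl , ℝ.refl
      ; sym   = map ℝ.sym ℝ.sym
      ; trans = zip ℝ.trans ℝ.trans
      }
    }

  ofReal : ℝ.Carrier → ℂ
  ofReal x = x +i 0#

  0ℂ 1ℂ 2ℂ : ℂ
  0ℂ = ofReal 0#
  1ℂ = ofReal 1#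
  2ℂ = ofReal (1# ℝ.+ 1#)

  _+_ _-_ _*_ : ℂ → ℂ → ℂ
  z + w = (re z ℝ.+ re w) +i (im z ℝ.+ im w)
  z - w = (re z ℝ.- re w) +i (im z ℝ.- im w)
  z * w = (re z ℝ.* re w ℝ.- im z ℝ.* im w) +i (re z ℝ.* im w ℝ.+ im z ℝ.* re w)

  -_ _² _⁻¹ : ℂ → ℂ
  - z = (ℝ.- re z) +i (ℝ.- im z)
  z ² = z * z

  ∣_∣² : ℂ → ℝ.Carrier
  ∣ z ∣² = re z ℝ.* re z ℝ.+ im z ℝ.* im z

  -- Conjugate over squared modulus; only meaningful for z ≉ 0ℂ.
  z ⁻¹ = (re z ℝ.* (∣ z ∣² ℝ.⁻¹)) +i ((ℝ.- im z) ℝ.* (∣ z ∣² ℝ.⁻¹))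

  0≤∣_∣² : ∀ z → 0# ≤ ∣ z ∣²
  0≤∣ z ∣² = ℝ.≤.trans (ℝ.0≤x*x (im z)) (ℝ.x≤y+x (ℝ.0≤x*x (re z)))

  ∣_∣ : ℂ → ℝ.Carrier
  ∣ z ∣ = ℝ.sqrt ∣ z ∣² 0≤∣ z ∣²

  0≤∣_∣ : ∀ z → 0# ≤ ∣ z ∣
  0≤∣ z ∣ = ℝ.0≤sqrt 0≤∣ z ∣²

  [_,∞⟩ : ℝ.Carrier → Pred ℂ 0ℓ
  [ a ,∞⟩ z = ∃ λ t → a ≤ t × z ≈ ofReal t

  ℂ∖[_,∞⟩ : ℝ.Carrier → Pred ℂ 0ℓ
  ℂ∖[ a ,∞⟩ = ∁ [ a ,∞⟩

  -- dist z = inf { ∣ z - t ∣ | t ∈ [0,∞) }, the infimum being obtained as the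
  -- supremum of the lower bounds.
  LowerBoundOfDistances : ℂ → Pred ℝ.Carrier 0ℓ
  LowerBoundOfDistances z d = ∀ {t} → 0# ≤ t → d ≤ ∣ z - ofReal t ∣

  dist-supremum : ∀ z → ∃ (IsSupremum _≤_ (LowerBoundOfDistances z))
  dist-supremum z = ℝ.supremum (LowerBoundOfDistances z)
    (0# , λ {t} _ → 0≤∣ z - ofReal t ∣)
    (∣ z - ofReal 0# ∣ , λ lower → lower ℝ.≤.refl)

  dist[_,ℝ₊] : ℂ → ℝ.Carrier
  dist[ z ,ℝ₊] = proj₁ (dist-supremum z)

  -- A function on a domain D is represented by one on ℂ, of which only the
  -- values on D are ever referred to.
  ComplexFunction : Set
  ComplexFunction = ℂ-setoid ⟶ₛ ℂ-setoid

  HasDerivativeAt : Pred ℂ 0ℓ → ComplexFunction → ℂ → ℂ → Set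
  HasDerivativeAt D f z f′ =
    ∀ {ε} → 0# < ε → Σ ℝ.Carrier λ δ → 0# < δ ×
      (∀ h → ¬ (h ≈ 0ℂ) → (z + h) ∈ D → ∣ h ∣ < δ →
        ∣ ((f ⟨$⟩ (z + h)) - (f ⟨$⟩ z)) * h ⁻¹ - f′ ∣ < ε)

  -- For open D.
  HolomorphicOn : Pred ℂ 0ℓ → ComplexFunction → Set
  HolomorphicOn D f = ∀ {z} → z ∈ D → ∃ (HasDerivativeAt D f z)

  ThreeTermEquation : ComplexFunction → Set
  ThreeTermEquation G = ∀ {z} → z ∈ ℂ∖[ 0# ,∞⟩ →
    - (1ℂ - z) ⁻¹
      - ((1ℂ - z) ²) ⁻¹ * (G ⟨$⟩ ((1ℂ - z) ⁻¹))
      + 2ℂ * (G ⟨$⟩ (z + 1ℂ))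
    ≈ (G ⟨$⟩ z)

  SymmetryEquation : ComplexFunction → Set
  SymmetryEquation G = ∀ {z} → z ∈ ℂ∖[ 0# ,∞⟩ →
    (G ⟨$⟩ (z + 1ℂ)) ≈ - (z ²) ⁻¹ * (G ⟨$⟩ (z ⁻¹ + 1ℂ)) - z ⁻¹

  VanishesFarFromℝ₊ : ComplexFunction → Set
  VanishesFarFromℝ₊ G = ∀ {ε} → 0# < ε → Σ ℝ.Carrier λ K →
    ∀ {z} → z ∈ ℂ∖[ 1# ,∞⟩ → K < dist[ z ,ℝ₊] → ∣ G ⟨$⟩ z ∣ < ε

module Submission where

open import Defs
open import Level using (0ℓ)
open import Algebra.Bundles using (CommutativeRing)
import Algebra.Properties.AbelianGroup as AbelianGroupProperties
import Algebra.Properties.CommutativeSemigroup as CommutativeSemigroupProperties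
import Algebra.Properties.Ring as RingProperties
import Algebra.Properties.Semiring.Mult.TCOptimised as Mult
import Algebra.Solver.Ring as RingSolver
open import Algebra.Solver.Ring.AlmostCommutativeRing
  using (fromCommutativeRing; _-Raw-AlmostCommutative⟶_)
open import Axiom.ExcludedMiddle using (ExcludedMiddle)
open import Data.Empty using (⊥-elim)
open import Data.Integer as ℤ using (ℤ; -[1+_]; _⊖_; _◃_; sign) renaming (+_ to +ᶻ_)
import Data.Integer.Properties as ℤ
open import Data.Maybe using (map)
open import Data.Nat as ℕ using (ℕ; zero; suc)
import Data.Nat.Properties as ℕ
open import Data.Product using (∃; _×_; _,_; proj₁; proj₂)
open import Data.Sign as Sign using (Sign)
open import Data.Sum using (_⊎_; inj₁; inj₂)
open import Function.Bundles using (Func; _⟨$⟩_)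
open import Relation.Binary.Bundles using (Setoid)
import Relation.Binary.PropositionalEquality as ≡
import Relation.Binary.Reasoning.PartialOrder as PosetReasoning
import Relation.Binary.Reasoning.Setoid as SetoidReasoning
open import Relation.Nullary using (¬_; Dec; yes; no; contradiction)
open import Relation.Nullary.Decidable using (dec⇒maybe)
open import Relation.Unary using (Pred; _∈_)

-- Let Δ = G₁ − G₂.  Eliminating the value at 1/(1 − z) from the three-term
-- equation by means of the symmetry gives, off [0,∞),
--   2 Δ(z + 1) = Δ(z) − z⁻² Δ(1/z).
-- On the half-plane re ≤ 0, Δ is bounded, being continuous and small at
-- infinity.  For re w ≤ 0 the recurrence at z = w − 1 bounds 2 ∣Δ(w)∣² by
-- ∣Δ(w − 1)∣² + ∣Δ(1/(w − 1))∣², so a value close to the supremum of ∣Δ∣² would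
-- persist along w, w − 1, w − 2, …, where Δ tends to 0: hence Δ = 0 there.
-- No analytic continuation is needed to go on.  If Δ(v + 1) ≠ 0, then by the
-- recurrence v − 1 or 1/v − 1 has the same property, and re v > 0.  But the
-- Euclidean algorithm drives every non-real number out of the right half-plane.

-- Condition (c) gives no control near the ray, so a bound for Δ on the whole domain is out of
-- reach. On the half-plane re ≤ 0 the distance to the ray is the modulus, and the recurrence stays
-- inside: w - 1 and its inverse both have real part at most 0, and ∣w - 1∣ ≥ 1 keeps the
-- coefficient z⁻² at modulus at most 1. What results is a plain mean, with no contraction to spare,
-- and the supremum over an unbounded set need not be attained. Hence the argument carries a deficit
-- below the supremum from far left, where decay supplies it, back to the imaginary axis; every unit
-- step halves it but leaves it positive. Squared moduli replace moduli, so that estimates become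
-- polynomial identities with a nonnegative remainder. The price is the 2 in ∣a - b∣² ≤ 2(∣a∣² +
-- ∣b∣²), which the coefficient 2 of the recurrence, squared, pays for. Suprema supply everything
-- that is usually drawn from compactness, from counting unit steps, or from the unboundedness of
-- powers of 2.

-- The solver has to recognise cancelling terms, and equality in R is undecidable:
-- hence coefficients in ℤ.
module IntegerCoefficientSolver (R : CommutativeRing 0ℓ 0ℓ) where
  open CommutativeRing R
  open RingProperties ring using (-‿distribˡ-*; -‿distribʳ-*; -‿involutive; -0#≈0#)
  open AbelianGroupProperties +-abelianGroup using (⁻¹-∙-comm)
  open CommutativeSemigroupProperties using (interchange)
  open Mult semiring renaming (_×_ to _·_)
  open SetoidReasoning setoid

  fromℤ : ℤ → Carrier
  fromℤ (+ᶻ n)   = n · 1#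
  fromℤ -[1+ n ] = - (suc n · 1#)

  -- Integer multiplication is defined through signs and absolute values, so multiplicativity of
  -- `fromℤ` is checked on these two factors separately.
  fromSign : Sign → Carrier
  fromSign Sign.+ = 1#
  fromSign Sign.- = - 1#

  fromℤ-neg : ∀ i → fromℤ (ℤ.- i) ≈ - fromℤ i
  fromℤ-neg (+ᶻ zero)  = sym -0#≈0#
  fromℤ-neg (+ᶻ suc n) = refl
  fromℤ-neg -[1+ n ]   = sym (-‿involutive _)

  fromℤ-⊖ : ∀ m n → fromℤ (m ⊖ n) ≈ m · 1# - n · 1#
  fromℤ-⊖ m       zero    = begin
    m · 1#       ≈⟨ +-identityʳ _ ⟨
    m · 1# + 0#  ≈⟨ +-congˡ -0#≈0# ⟨
    m · 1# - 0#  ∎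
  fromℤ-⊖ zero    (suc n) = sym (+-identityˡ _)
  fromℤ-⊖ (suc m) (suc n) = begin
    fromℤ (suc m ⊖ suc n)              ≡⟨ ≡.cong fromℤ (ℤ.[1+m]⊖[1+n]≡m⊖n m n) ⟩
    fromℤ (m ⊖ n)                      ≈⟨ fromℤ-⊖ m n ⟩
    m · 1# - n · 1#                    ≈⟨ +-identityˡ _ ⟨
    0# + (m · 1# - n · 1#)             ≈⟨ +-congʳ (-‿inverseʳ 1#) ⟨
    (1# - 1#) + (m · 1# - n · 1#)      ≈⟨ interchange +-commutativeSemigroup _ _ _ _ ⟩
    (1# + m · 1#) + (- 1# - n · 1#)    ≈⟨ +-congˡ (⁻¹-∙-comm _ _) ⟩
    (1# + m · 1#) - (1# + n · 1#)      ≈⟨ +-cong (1+× m 1#) (-‿cong (1+× n 1#)) ⟨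
    suc m · 1# - suc n · 1#            ∎

  fromℤ-+ : ∀ i j → fromℤ (i ℤ.+ j) ≈ fromℤ i + fromℤ j
  fromℤ-+ (+ᶻ m)   (+ᶻ n)   = ×-homo-+ 1# m n
  fromℤ-+ (+ᶻ m)   -[1+ n ] = fromℤ-⊖ m (suc n)
  fromℤ-+ -[1+ m ] (+ᶻ n)   = trans (fromℤ-⊖ n (suc m)) (+-comm _ _)
  fromℤ-+ -[1+ m ] -[1+ n ] = begin
    - (suc (suc (m ℕ.+ n)) · 1#)         ≡⟨ ≡.cong (λ k → - (suc k · 1#)) (ℕ.+-suc m n) ⟨
    - ((suc m ℕ.+ suc n) · 1#)           ≈⟨ -‿cong (×-homo-+ 1# (suc m) (suc n)) ⟩
    - (suc m · 1# + suc n · 1#)          ≈⟨ ⁻¹-∙-comm _ _ ⟨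
    - (suc m · 1#) - suc n · 1#          ∎

  fromSign-* : ∀ s t → fromSign (s Sign.* t) ≈ fromSign s * fromSign t
  fromSign-* Sign.+ t      = sym (*-identityˡ _)
  fromSign-* Sign.- Sign.+ = sym (*-identityʳ _)
  fromSign-* Sign.- Sign.- = begin
    1#                ≈⟨ -‿involutive 1# ⟨
    - - 1#            ≈⟨ -‿cong (*-identityʳ _) ⟨
    - (- 1# * 1#)     ≈⟨ -‿distribʳ-* _ _ ⟩
    - 1# * - 1#       ∎

  fromℤ-◃ : ∀ s n → fromℤ (s ◃ n) ≈ fromSign s * (n · 1#)
  fromℤ-◃ s      zero    = sym (zeroʳ _)
  fromℤ-◃ Sign.+ (suc n) = sym (*-identityˡ _)
  fromℤ-◃ Sign.- (suc n) = begin
    - (suc n · 1#)         ≈⟨ -‿cong (*-identityˡ _) ⟨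
    - (1# * (suc n · 1#))  ≈⟨ -‿distribˡ-* _ _ ⟩
    - 1# * (suc n · 1#)    ∎

  fromℤ-sign-abs : ∀ i → fromℤ i ≈ fromSign (sign i) * (ℤ.∣ i ∣ · 1#)
  fromℤ-sign-abs i = begin
    fromℤ i                   ≡⟨ ≡.cong fromℤ (ℤ.signᵢ◃∣i∣≡i i) ⟨
    fromℤ (sign i ◃ ℤ.∣ i ∣)  ≈⟨ fromℤ-◃ (sign i) ℤ.∣ i ∣ ⟩
    fromSign (sign i) * (ℤ.∣ i ∣ · 1#) ∎

  fromℤ-* : ∀ i j → fromℤ (i ℤ.* j) ≈ fromℤ i * fromℤ j
  fromℤ-* i j = begin
    fromℤ (i ℤ.* j)
      ≈⟨ fromℤ-◃ (sign i Sign.* sign j) (ℤ.∣ i ∣ ℕ.* ℤ.∣ j ∣) ⟩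
    fromSign (sign i Sign.* sign j) * ((ℤ.∣ i ∣ ℕ.* ℤ.∣ j ∣) · 1#)
      ≈⟨ *-cong (fromSign-* (sign i) (sign j)) (×1-homo-* ℤ.∣ i ∣ ℤ.∣ j ∣) ⟩
    fromSign (sign i) * fromSign (sign j) * ((ℤ.∣ i ∣ · 1#) * (ℤ.∣ j ∣ · 1#))
      ≈⟨ interchange *-commutativeSemigroup _ _ _ _ ⟩
    fromSign (sign i) * (ℤ.∣ i ∣ · 1#) * (fromSign (sign j) * (ℤ.∣ j ∣ · 1#))
      ≈⟨ *-cong (fromℤ-sign-abs i) (fromℤ-sign-abs j) ⟨
    fromℤ i * fromℤ j ∎

  morphism : ℤ.+-*-rawRing -Raw-AlmostCommutative⟶ fromCommutativeRing R
  morphism = record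
    { ⟦_⟧    = fromℤ
    ; +-homo = fromℤ-+
    ; *-homo = fromℤ-*
    ; -‿homo = fromℤ-neg
    ; 0-homo = refl
    ; 1-homo = refl
    }

  open RingSolver ℤ.+-*-rawRing (fromCommutativeRing R) morphism
    (λ i j → map (λ i≡j → reflexive (≡.cong fromℤ i≡j)) (dec⇒maybe (i ℤ.≟ j)))
    public using (Polynomial; solve; con; _:=_; _:+_; _:*_; _:-_; :-_)

  :0 :1 :2 : ∀ {n} → Polynomial n
  :0 = con (+ᶻ 0)
  :1 = con (+ᶻ 1)
  :2 = con (+ᶻ 2)

-- Algebra behind the functional equations

module RingIdentities (R : CommutativeRing 0ℓ 0ℓ) where
  open CommutativeRing R
  open IntegerCoefficientSolver R

  -- With `n` the inverse of `h`, this recovers a function value from its difference quotient, split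
  -- into the error against the derivative `f` and `f` itself.
  difference-quotient : ∀ v u h n f → h * n ≈ 1# → v ≈ u + h * ((v - u) * n - f + f)
  difference-quotient v u h n f hn≈1 = sym (trans
    (solve 5 (λ v u h n f → u :+ h :* ((v :- u) :* n :- f :+ f) := u :+ h :* n :* (v :- u))
      refl v u h n f)
    (trans (+-congˡ (trans (*-congʳ hn≈1) (*-identityˡ _)))
      (solve 2 (λ v u → u :+ (v :- u) := v) refl v u)))

  x≈y+[x-y] : ∀ x y → x ≈ y + (x - y)
  x≈y+[x-y] = solve 2 (λ x y → x := y :+ (x :- y)) refl

  right-inverse-unique : ∀ {x y n} → x * y ≈ 1# → x * n ≈ 1# → y ≈ n
  right-inverse-unique {x} {y} {n} xy≈1 xn≈1 = trans (sym (*-identityʳ y)) (trans (*-congˡ (sym xn≈1))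
    (trans (solve 3 (λ x y n → y :* (x :* n) := x :* y :* n) refl x y n)
      (trans (*-congʳ xy≈1) (*-identityˡ n))))

  -- The inhomogeneous terms are the same for both solutions and cancel, so the difference obeys a
  -- linear homogeneous equation.
  three-term-difference : ∀ {p s t x₁ y₁ z₁ x₂ y₂ z₂} →
    - p - s * x₁ + t * y₁ ≈ z₁ → - p - s * x₂ + t * y₂ ≈ z₂ →
    z₁ - z₂ ≈ t * (y₁ - y₂) - s * (x₁ - x₂)
  three-term-difference {p} {s} {t} {x₁} {y₁} {z₁} {x₂} {y₂} {z₂} eq₁ eq₂ =
    trans (+-cong (sym eq₁) (-‿cong (sym eq₂)))
      (solve 7 (λ p s t x₁ y₁ x₂ y₂ →
        (:- p :- s :* x₁ :+ t :* y₁) :- (:- p :- s :* x₂ :+ t :* y₂)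
        := t :* (y₁ :- y₂) :- s :* (x₁ :- x₂)) refl p s t x₁ y₁ x₂ y₂)

  symmetry-difference : ∀ {s r x₁ y₁ x₂ y₂} → y₁ ≈ - s * x₁ - r → y₂ ≈ - s * x₂ - r →
    y₁ - y₂ ≈ - s * (x₁ - x₂)
  symmetry-difference {s} {r} {x₁} {y₁} {x₂} {y₂} eq₁ eq₂ =
    trans (+-cong eq₁ (-‿cong eq₂))
      (solve 4 (λ s r x₁ x₂ → (:- s :* x₁ :- r) :- (:- s :* x₂ :- r) := :- s :* (x₁ :- x₂))
        refl s r x₁ x₂)

  [1-z]*[p-1]≈z : ∀ {z p} → (1# - z) * p ≈ 1# → (1# - z) * (p - 1#) ≈ z
  [1-z]*[p-1]≈z {z} {p} ap≈1 = trans
    (solve 2 (λ z p → (:1 :- z) :* (p :- :1) := (:1 :- z) :* p :- (:1 :- z)) refl z p)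
    (trans (+-congʳ ap≈1) (solve 1 (λ z → :1 :- (:1 :- z) := z) refl z))

  -- r = 1/z and p = 1/(1 − z)
  [r-1]*[p-1]≈1 : ∀ {z r p} → z * r ≈ 1# → (1# - z) * p ≈ 1# → (r - 1#) * (p - 1#) ≈ 1#
  [r-1]*[p-1]≈1 {z} {r} {p} zr≈1 ap≈1 = trans
    (solve 3 (λ z r p → (r :- :1) :* (p :- :1)
       := (r :- :1) :* ((:1 :- z) :* p :- :1) :+ p :* (z :* r) :- z :* p) refl z r p)
    (trans (+-congʳ (+-cong (*-congˡ (+-congʳ ap≈1)) (*-congˡ zr≈1)))
      (trans (solve 3 (λ z r p → (r :- :1) :* (:1 :- :1) :+ p :* :1 :- z :* p
                         := (:1 :- z) :* p) refl z r p) ap≈1))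

  inverse-square : ∀ {x n} → x * n ≈ 1# → x * x * (n * n) ≈ 1#
  inverse-square {x} {n} xn≈1 = trans (solve 2 (λ x n → x :* x :* (n :* n) := x :* n :* (x :* n)) refl x n)
    (trans (*-cong xn≈1 xn≈1) (*-identityˡ 1#))

  inverse-product : ∀ {x y s t} → x * s ≈ 1# → y * t ≈ 1# → x * y * (s * t) ≈ 1#
  inverse-product {x} {y} {s} {t} xs≈1 yt≈1 = trans
    (solve 4 (λ x y s t → x :* y :* (s :* t) := x :* s :* (y :* t)) refl x y s t)
    (trans (*-cong xs≈1 yt≈1) (*-identityˡ 1#))

  -- With p = 1/(1 - z) one has (1 - z)(p - 1) = z. The coefficients of the two functional equations
  -- therefore multiply to z⁻².
  product-of-inverse-squares : ∀ {z r p s t} → z * r ≈ 1# → (1# - z) * p ≈ 1# →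
    (1# - z) * (1# - z) * s ≈ 1# → (p - 1#) * (p - 1#) * t ≈ 1# → s * t ≈ r * r
  product-of-inverse-squares {z} {r} {p} {s} {t} zr≈1 ap≈1 aas≈1 yyt≈1 =
    right-inverse-unique (trans (*-congʳ z*z≈) (inverse-product aas≈1 yyt≈1)) (inverse-square zr≈1)
    where
    z*z≈ : z * z ≈ (1# - z) * (1# - z) * ((p - 1#) * (p - 1#))
    z*z≈ = trans (*-cong (sym ([1-z]*[p-1]≈z ap≈1)) (sym ([1-z]*[p-1]≈z ap≈1)))
      (solve 2 (λ a y → a :* y :* (a :* y) := a :* a :* (y :* y)) refl (1# - z) (p - 1#))

  eliminate : ∀ {s t k u v w x y} → u ≈ k * v - s * w → w ≈ - t * x → s * t ≈ y →
    k * v ≈ u - y * x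
  eliminate {s} {t} {k} {u} {v} {w} {x} {y} u≈ w≈ st≈y = sym (trans
    (+-cong (trans u≈ (+-congˡ (-‿cong (*-congˡ w≈)))) (-‿cong (*-congʳ (sym st≈y))))
    (solve 5 (λ s t k v x → k :* v :- s :* (:- t :* x) :- s :* t :* x := k :* v) refl s t k v x))

  [r-1]*z≈1-z : ∀ {z r} → z * r ≈ 1# → (r - 1#) * z ≈ 1# - z
  [r-1]*z≈1-z {z} {r} zr≈1 = trans
    (solve 2 (λ z r → (r :- :1) :* z := z :* r :- z) refl z r) (+-congʳ zr≈1)

  x-y≈0⇒x≈y : ∀ {x y} → x - y ≈ 0# → x ≈ y
  x-y≈0⇒x≈y {x} {y} x-y≈0 = trans (x≈y+[x-y] x y) (trans (+-congˡ x-y≈0) (+-identityʳ y))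

  0-x*0≈0 : ∀ x → 0# - x * 0# ≈ 0#
  0-x*0≈0 = solve 1 (λ x → :0 :- x :* :0 := :0) refl

module Uniqueness (em : ExcludedMiddle 0ℓ) (ℝ : CompleteOrderedField) where
  open CompleteOrderedField ℝ
  open IntegerCoefficientSolver commutativeRing
  open PosetReasoning poset

  -- Ordered fields

  -- The working form of most inequalities below: the difference is exhibited as a visibly
  -- nonnegative expression, and the ring solver checks the identity.
  ≤-certificate : ∀ {x y e} → 0# ≤ e → e ≈ y - x → x ≤ y
  ≤-certificate 0≤e e≈y-x = 0≤y-x⇒x≤y (≤.trans 0≤e (≤.reflexive e≈y-x))

  ≤-resp : ∀ {x x′ y y′} → x ≈ x′ → y ≈ y′ → x ≤ y → x′ ≤ y′
  ≤-resp x≈x′ y≈y′ x≤y = ≤.trans (≤.reflexive (sym x≈x′)) (≤.trans x≤y (≤.reflexive y≈y′))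

  +-nonNegative : ∀ {x y} → 0# ≤ x → 0# ≤ y → 0# ≤ x + y
  +-nonNegative 0≤x 0≤y = ≤.trans 0≤y (x≤y+x 0≤x)

  <⇒≱ : ∀ {x y} → x < y → ¬ (y ≤ x)
  <⇒≱ (x≤y , x≉y) y≤x = x≉y (≤.antisym x≤y y≤x)

  ≰⇒> : ∀ {x y} → ¬ (x ≤ y) → y < x
  ≰⇒> {x} {y} x≰y with ≤.total x y
  ... | inj₁ x≤y = contradiction x≤y x≰y
  ... | inj₂ y≤x = y≤x , λ y≈x → x≰y (≤.reflexive (sym y≈x))

  ≮⇒≥ : ∀ {x y} → ¬ (x < y) → y ≤ x
  ≮⇒≥ {x} {y} x≮y with em {y ≤ x}
  ... | yes y≤x = y≤x
  ... | no  y≰x = contradiction (≰⇒> y≰x) x≮y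

  <-≤-trans : ∀ {x y z} → x < y → y ≤ z → x < z
  <-≤-trans x<y y≤z = ≰⇒> λ z≤x → <⇒≱ x<y (≤.trans y≤z z≤x)

  ≤-<-trans : ∀ {x y z} → x ≤ y → y < z → x < z
  ≤-<-trans x≤y y<z = ≰⇒> λ z≤x → <⇒≱ y<z (≤.trans z≤x x≤y)

  0<⇒≉0 : ∀ {x} → 0# < x → ¬ (x ≈ 0#)
  0<⇒≉0 (_ , 0≉x) x≈0 = 0≉x (sym x≈0)

  *-zero-product : ∀ {x y} → ¬ (x ≈ 0#) → x * y ≈ 0# → y ≈ 0#
  *-zero-product {x} {y} x≉0 xy≈0 = begin-equality
    y                ≈⟨ *-identityˡ y ⟨
    1# * y           ≈⟨ *-congʳ (⁻¹-inverseʳ x≉0) ⟨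
    x * x ⁻¹ * y     ≈⟨ solve 3 (λ x n y → x :* n :* y := n :* (x :* y)) refl x (x ⁻¹) y ⟩
    x ⁻¹ * (x * y)   ≈⟨ *-congˡ xy≈0 ⟩
    x ⁻¹ * 0#        ≈⟨ zeroʳ _ ⟩
    0#               ∎

  0<1 : 0# < 1#
  0<1 = 0≤1 , 0≉1

  *-positive : ∀ {x y} → 0# < x → 0# < y → 0# < x * y
  *-positive 0<x 0<y = *-nonNegative (proj₁ 0<x) (proj₁ 0<y) ,
    λ 0≈xy → 0<⇒≉0 0<y (*-zero-product (0<⇒≉0 0<x) (sym 0≈xy))

  ⁻¹-positive : ∀ {x} → 0# < x → 0# < x ⁻¹
  ⁻¹-positive {x} 0<x = 0≤x⁻¹ , λ 0≈x⁻¹ → 0≉1 (begin-equality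
    0#        ≈⟨ zeroʳ x ⟨
    x * 0#    ≈⟨ *-congˡ 0≈x⁻¹ ⟩
    x * x ⁻¹  ≈⟨ ⁻¹-inverseʳ (0<⇒≉0 0<x) ⟩
    1#        ∎)
    where
    0≤x⁻¹ : 0# ≤ x ⁻¹
    0≤x⁻¹ = begin
      0#                   ≤⟨ *-nonNegative (proj₁ 0<x) (0≤x*x (x ⁻¹)) ⟩
      x * (x ⁻¹ * x ⁻¹)    ≈⟨ *-assoc x _ _ ⟨
      x * x ⁻¹ * x ⁻¹      ≈⟨ *-congʳ (⁻¹-inverseʳ (0<⇒≉0 0<x)) ⟩
      1# * x ⁻¹            ≈⟨ *-identityˡ _ ⟩
      x ⁻¹                 ∎

  *-cancel-nonNegative : ∀ {x y} → 0# < x → 0# ≤ x * y → 0# ≤ y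
  *-cancel-nonNegative {x} {y} 0<x 0≤xy = begin
    0#                ≤⟨ *-nonNegative (proj₁ (⁻¹-positive 0<x)) 0≤xy ⟩
    x ⁻¹ * (x * y)    ≈⟨ solve 3 (λ x n y → n :* (x :* y) := x :* n :* y) refl x (x ⁻¹) y ⟩
    x * x ⁻¹ * y      ≈⟨ *-congʳ (⁻¹-inverseʳ (0<⇒≉0 0<x)) ⟩
    1# * y            ≈⟨ *-identityˡ y ⟩
    y                 ∎

  *-cancelˡ-≤ : ∀ {x y z} → 0# < x → x * y ≤ x * z → y ≤ z
  *-cancelˡ-≤ {x} {y} {z} 0<x xy≤xz = 0≤y-x⇒x≤y (*-cancel-nonNegative 0<x
    (≤.trans (x≤y⇒0≤y-x xy≤xz)
      (≤.reflexive (solve 3 (λ x y z → x :* z :- x :* y := x :* (z :- y)) refl x y z))))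

  *-monoˡ-≤ : ∀ {x y z} → 0# ≤ x → y ≤ z → x * y ≤ x * z
  *-monoˡ-≤ {x} {y} {z} 0≤x y≤z = ≤-certificate (*-nonNegative 0≤x (x≤y⇒0≤y-x y≤z))
    (solve 3 (λ x y z → x :* (z :- y) := x :* z :- x :* y) refl x y z)

  *-mono-≤ : ∀ {w x y z} → 0# ≤ x → 0# ≤ y → w ≤ x → y ≤ z → w * y ≤ x * z
  *-mono-≤ {w} {x} {y} {z} 0≤x 0≤y w≤x y≤z = begin
    w * y  ≈⟨ *-comm w y ⟩
    y * w  ≤⟨ *-monoˡ-≤ 0≤y w≤x ⟩
    y * x  ≈⟨ *-comm y x ⟩
    x * y  ≤⟨ *-monoˡ-≤ 0≤x y≤z ⟩
    x * z  ∎

  x*x≤0⇒x≈0 : ∀ {x} → x * x ≤ 0# → x ≈ 0#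
  x*x≤0⇒x≈0 {x} x*x≤0 with em {x ≈ 0#}
  ... | yes x≈0 = x≈0
  ... | no  x≉0 = *-zero-product x≉0 (≤.antisym x*x≤0 (0≤x*x x))

  -- If y ≤ x, then -(x - y)² is the sum of y² - x² and 2y(x - y), both nonnegative, so x - y
  -- vanishes.
  square-cancel-≤ : ∀ {x y} → 0# ≤ y → x * x ≤ y * y → x ≤ y
  square-cancel-≤ {x} {y} 0≤y x*x≤y*y with ≤.total x y
  ... | inj₁ x≤y = x≤y
  ... | inj₂ y≤x = ≤-certificate ≤.refl (sym (x*x≤0⇒x≈0 (≤-certificate
    (+-nonNegative (x≤y⇒0≤y-x x*x≤y*y)
      (+-nonNegative (*-nonNegative 0≤y 0≤x-y) (*-nonNegative 0≤y 0≤x-y)))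
    (solve 2 (λ x y → y :* y :- x :* x :+ (y :* (x :- y) :+ y :* (x :- y))
                      := :0 :- (y :- x) :* (y :- x)) refl x y) )) )
    where
    0≤x-y = x≤y⇒0≤y-x y≤x

  2# : Carrier
  2# = 1# + 1#

  0<2 : 0# < 2#
  0<2 = <-≤-trans 0<1 (x≤y+x 0≤1)

  half : Carrier → Carrier
  half x = 2# ⁻¹ * x

  half+half : ∀ x → half x + half x ≈ x
  half+half x = begin-equality
    2# ⁻¹ * x + 2# ⁻¹ * x  ≈⟨ solve 2 (λ n x → n :* x :+ n :* x := :2 :* n :* x) refl (2# ⁻¹) x ⟩
    2# * 2# ⁻¹ * x         ≈⟨ *-congʳ (⁻¹-inverseʳ (0<⇒≉0 0<2)) ⟩
    1# * x                 ≈⟨ *-identityˡ x ⟩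
    x                      ∎

  half-positive : ∀ {x} → 0# < x → 0# < half x
  half-positive = *-positive (⁻¹-positive 0<2)

  half≤ : ∀ {x} → 0# ≤ x → half x ≤ x
  half≤ {x} 0≤x = ≤.trans
    (x≤y+x (*-nonNegative (proj₁ (⁻¹-positive 0<2)) 0≤x)) (≤.reflexive (half+half x))

  half< : ∀ {x} → 0# < x → half x < x
  half< {x} 0<x = half≤ (proj₁ 0<x) , λ h≈x → 0<⇒≉0 0<x (begin-equality
    x                ≈⟨ solve 1 (λ x → x := x :+ x :- x) refl x ⟩
    x + x - x        ≈⟨ +-congʳ (+-cong h≈x h≈x) ⟨
    half x + half x - x ≈⟨ +-congʳ (half+half x) ⟩
    x - x            ≈⟨ -‿inverseʳ x ⟩
    0#               ∎)

  common-upper-bound : ∀ x y → ∃ λ b → x ≤ b × y ≤ b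
  common-upper-bound x y with ≤.total x y
  ... | inj₁ x≤y = y , x≤y , ≤.refl
  ... | inj₂ y≤x = x , ≤.refl , y≤x

  common-positive-lower-bound : ∀ {x y} → 0# < x → 0# < y → ∃ λ b → 0# < b × b ≤ x × b ≤ y
  common-positive-lower-bound {x} {y} 0<x 0<y with ≤.total x y
  ... | inj₁ x≤y = x , 0<x , ≤.refl , x≤y
  ... | inj₂ y≤x = y , 0<y , y≤x , ≤.refl

  -- The witness min(1, ε) serves, since ε² ≤ ε below 1. It turns a bound on a modulus into one on
  -- its square.
  positive-square-below : ∀ {ε} → 0# < ε → ∃ λ e → 0# < e × e * e ≤ ε
  positive-square-below {ε} 0<ε with ≤.total 1# ε
  ... | inj₁ 1≤ε = 1# , 0<1 , ≤.trans (≤.reflexive (*-identityˡ 1#)) 1≤ε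
  ... | inj₂ ε≤1 = ε , 0<ε , ≤.trans (*-monoˡ-≤ (proj₁ 0<ε) ε≤1) (≤.reflexive (*-identityʳ ε))

  -- Neighbourhoods of radius 1/2 have length 1, so an interval induction with them advances by
  -- steps that a single shift by 1 covers.
  near⇒≤+1 : ∀ {x s t} → x - half 1# ≤ s → t ≤ x + half 1# → t ≤ s + 1#
  near⇒≤+1 {x} {s} {t} x-δ≤s t≤x+δ = ≤-resp refl (+-congˡ (half+half 1#))
    (≤-certificate (+-nonNegative (x≤y⇒0≤y-x x-δ≤s) (x≤y⇒0≤y-x t≤x+δ))
      (solve 4 (λ x s t δ → s :- (x :- δ) :+ (x :+ δ :- t) := s :+ (δ :+ δ) :- t)
        refl x s t (half 1#)))

  -- Cousin's lemma: b is the supremum of the t with Q a t, and is attained.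
  interval-induction : (Q : Carrier → Carrier → Set) →
    (∀ {s t u} → s ≤ t → t ≤ u → Q s t → Q t u → Q s u) →
    ∀ {a b} → a ≤ b →
    (∀ {x} → a ≤ x → x ≤ b → ∃ λ δ → 0# < δ ×
      (∀ {s t} → a ≤ s → s ≤ x → x ≤ t → t ≤ b → x - δ ≤ s → t ≤ x + δ → Q s t)) →
    Q a b
  interval-induction Q glue {a} {b} a≤b local = conclusion
    where
    x-δ≤x : ∀ {x δ} → 0# < δ → x - δ ≤ x
    x-δ≤x {x} {δ} (0≤δ , _) = ≤-certificate 0≤δ (solve 2 (λ x δ → δ := x :- (x :- δ)) refl x δ)

    x≤x+δ : ∀ {x δ} → 0# < δ → x ≤ x + δ
    x≤x+δ {x} {δ} (0≤δ , _) = ≤-certificate 0≤δ (solve 2 (λ x δ → δ := x :+ δ :- x) refl x δ)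

    Reached : Carrier → Set
    Reached t = a ≤ t × t ≤ b × Q a t

    a-reached : Reached a
    a-reached with local ≤.refl a≤b
    ... | δ , 0<δ , near = ≤.refl , a≤b ,
      near ≤.refl ≤.refl ≤.refl a≤b (x-δ≤x 0<δ) (x≤x+δ 0<δ)

    conclusion : Q a b
    conclusion with supremum Reached (a , a-reached) (b , λ (_ , t≤b , _) → t≤b)
    ... | c , upper , least with local (upper a-reached) (least λ (_ , t≤b , _) → t≤b)
    ... | δ , 0<δ , near with em {∃ λ t → c - δ ≤ t × Reached t}
    -- With no reached point from `c - δ` on, `c - δ` would be a smaller upper bound.
    ... | no none = contradiction
      (≤-certificate (x≤y⇒0≤y-x (least below))
        (solve 2 (λ c δ → c :- δ :- c := :0 :- δ) refl c δ))
      (<⇒≱ 0<δ)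
      where
      below : UpperBound _≤_ Reached (c - δ)
      below {t} t-reached with ≤.total t (c - δ)
      ... | inj₁ t≤c-δ = t≤c-δ
      ... | inj₂ c-δ≤t = contradiction (t , c-δ≤t , t-reached) none
    ... | yes (t , c-δ≤t , t-reached@(a≤t , t≤b , Qat)) with ≤.total b (c + δ)
    ...   | inj₁ b≤c+δ = glue a≤t t≤b Qat
      (near a≤t (upper t-reached) (least λ (_ , t≤b , _) → t≤b) ≤.refl c-δ≤t b≤c+δ)
    -- Here `c + δ` itself would be reached, beyond the supremum.
    ...   | inj₂ c+δ≤b = contradiction
      (≤-certificate (x≤y⇒0≤y-x (upper (≤.trans a≤c (x≤x+δ 0<δ) , c+δ≤b , glue a≤t t≤c+δ Qat
        (near a≤t t≤c (x≤x+δ 0<δ) c+δ≤b c-δ≤t ≤.refl))))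
        (solve 2 (λ c δ → c :- (c :+ δ) := :0 :- δ) refl c δ))
      (<⇒≱ 0<δ)
      where
      a≤c = upper a-reached
      t≤c = upper t-reached
      t≤c+δ = ≤.trans t≤c (x≤x+δ 0<δ)

  -- Complex numbers

  open ComplexNumbers ℝ
    renaming (_+_ to _+ᶜ_; _*_ to _*ᶜ_; _-_ to _-ᶜ_; -_ to -ᶜ_; _⁻¹ to _⁻¹ᶜ; _≈_ to _≈ᶜ_)

  ℂ-commutativeRing : CommutativeRing 0ℓ 0ℓ
  ℂ-commutativeRing = record
    { Carrier = ℂ ; _≈_ = _≈ᶜ_ ; _+_ = _+ᶜ_ ; _*_ = _*ᶜ_ ; -_ = -ᶜ_ ; 0# = 0ℂ ; 1# = 1ℂ
    ; isCommutativeRing = record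
      { isRing = record
        { +-isAbelianGroup = record
          { isGroup = record
            { isMonoid = record
              { isSemigroup = record
                { isMagma = record
                  { isEquivalence = Setoid.isEquivalence ℂ-setoid
                  ; ∙-cong = λ (p , q) (r , s) → +-cong p r , +-cong q s
                  }
                ; assoc = λ u v w → +-assoc _ _ _ , +-assoc _ _ _
                }
              ; identity = (λ z → +-identityˡ _ , +-identityˡ _)
                         , (λ z → +-identityʳ _ , +-identityʳ _)
              }
            ; inverse = (λ z → -‿inverseˡ _ , -‿inverseˡ _)
                      , (λ z → -‿inverseʳ _ , -‿inverseʳ _)
            ; ⁻¹-cong = λ (p , q) → -‿cong p , -‿cong q
            }
          ; comm = λ z w → +-comm _ _ , +-comm _ _
          }
        ; *-cong = λ (p , q) (r , s) →
            +-cong (*-cong p r) (-‿cong (*-cong q s)) , +-cong (*-cong p s) (*-cong q r)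
        ; *-assoc = λ (a +i b) (c +i d) (e +i f) →
            solve 6 (λ a b c d e f →
              (a :* c :- b :* d) :* e :- (a :* d :+ b :* c) :* f
              := a :* (c :* e :- d :* f) :- b :* (c :* f :+ d :* e)) refl a b c d e f ,
            solve 6 (λ a b c d e f →
              (a :* c :- b :* d) :* f :+ (a :* d :+ b :* c) :* e
              := a :* (c :* f :+ d :* e) :+ b :* (c :* e :- d :* f)) refl a b c d e f
        ; *-identity =
            (λ (a +i b) → solve 2 (λ a b → :1 :* a :- :0 :* b := a) refl a b ,
                          solve 2 (λ a b → :1 :* b :+ :0 :* a := b) refl a b) ,
            (λ (a +i b) → solve 2 (λ a b → a :* :1 :- b :* :0 := a) refl a b ,
                          solve 2 (λ a b → a :* :0 :+ b :* :1 := b) refl a b)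
        ; distrib =
            (λ (a +i b) (c +i d) (e +i f) →
              solve 6 (λ a b c d e f → a :* (c :+ e) :- b :* (d :+ f)
                := (a :* c :- b :* d) :+ (a :* e :- b :* f)) refl a b c d e f ,
              solve 6 (λ a b c d e f → a :* (d :+ f) :+ b :* (c :+ e)
                := (a :* d :+ b :* c) :+ (a :* f :+ b :* e)) refl a b c d e f) ,
            (λ (a +i b) (c +i d) (e +i f) →
              solve 6 (λ a b c d e f → (c :+ e) :* a :- (d :+ f) :* b
                := (c :* a :- d :* b) :+ (e :* a :- f :* b)) refl a b c d e f ,
              solve 6 (λ a b c d e f → (c :+ e) :* b :+ (d :+ f) :* a
                := (c :* b :+ d :* a) :+ (e :* b :+ f :* a)) refl a b c d e f)
        }
      ; *-comm = λ (a +i b) (c +i d) →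
          solve 4 (λ a b c d → a :* c :- b :* d := c :* a :- d :* b) refl a b c d ,
          solve 4 (λ a b c d → a :* d :+ b :* c := c :* b :+ d :* a) refl a b c d
      }
    }

  private
    module ℂ′ = CommutativeRing ℂ-commutativeRing

  open RingIdentities ℂ-commutativeRing

  ∣∣²-cong : ∀ {z w} → z ≈ᶜ w → ∣ z ∣² ≈ ∣ w ∣²
  ∣∣²-cong (p , q) = +-cong (*-cong p p) (*-cong q q)

  ∣∣²-* : ∀ z w → ∣ z *ᶜ w ∣² ≈ ∣ z ∣² * ∣ w ∣²
  ∣∣²-* (a +i b) (c +i d) = solve 4 (λ a b c d →
    (a :* c :- b :* d) :* (a :* c :- b :* d) :+ (a :* d :+ b :* c) :* (a :* d :+ b :* c)
    := (a :* a :+ b :* b) :* (c :* c :+ d :* d)) refl a b c d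

  -- By the parallelogram law the two sides differ by ∣z - w∣².
  ∣∣²-+ : ∀ z w → ∣ z +ᶜ w ∣² ≤ 2# * (∣ z ∣² + ∣ w ∣²)
  ∣∣²-+ (a +i b) (c +i d) = ≤-certificate (0≤∣ (a - c) +i (b - d) ∣²) (solve 4 (λ a b c d →
    (a :- c) :* (a :- c) :+ (b :- d) :* (b :- d)
    := :2 :* ((a :* a :+ b :* b) :+ (c :* c :+ d :* d))
       :- ((a :+ c) :* (a :+ c) :+ (b :+ d) :* (b :+ d))) refl a b c d)

  ∣∣²-neg : ∀ z → ∣ -ᶜ z ∣² ≈ ∣ z ∣²
  ∣∣²-neg (a +i b) =
    solve 2 (λ a b → (:- a) :* (:- a) :+ (:- b) :* (:- b) := a :* a :+ b :* b) refl a b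

  ∣∣²-‿- : ∀ z w → ∣ z -ᶜ w ∣² ≤ 2# * (∣ z ∣² + ∣ w ∣²)
  ∣∣²-‿- z w = ≤.trans (∣∣²-+ z (-ᶜ w)) (≤.reflexive (*-congˡ (+-congˡ (∣∣²-neg w))))

  re²≤∣∣² : ∀ z → re z * re z ≤ ∣ z ∣²
  re²≤∣∣² z = ≤.trans (x≤y+x (0≤x*x (im z))) (≤.reflexive (+-comm _ _))

  im²≤∣∣² : ∀ z → im z * im z ≤ ∣ z ∣²
  im²≤∣∣² z = x≤y+x (0≤x*x (re z))

  ∣z∣²≤0⇒z≈0 : ∀ {z} → ∣ z ∣² ≤ 0# → z ≈ᶜ 0ℂ
  ∣z∣²≤0⇒z≈0 {z} ∣z∣²≤0 = x*x≤0⇒x≈0 (≤.trans (re²≤∣∣² z) ∣z∣²≤0)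
                       , x*x≤0⇒x≈0 (≤.trans (im²≤∣∣² z) ∣z∣²≤0)

  ∣z∣²-positive : ∀ {z} → ¬ (z ≈ᶜ 0ℂ) → 0# < ∣ z ∣²
  ∣z∣²-positive z≉0 = ≰⇒> λ ∣z∣²≤0 → z≉0 (∣z∣²≤0⇒z≈0 ∣z∣²≤0)

  0ℂ≉1ℂ : ¬ (0ℂ ≈ᶜ 1ℂ)
  0ℂ≉1ℂ (0≈1 , _) = 0≉1 0≈1

  ⁻¹ᶜ-cong : ∀ {z w} → z ≈ᶜ w → z ⁻¹ᶜ ≈ᶜ w ⁻¹ᶜ
  ⁻¹ᶜ-cong z≈w@(p , q) = *-cong p N , *-cong (-‿cong q) N
    where N = ⁻¹-cong (∣∣²-cong z≈w)

  ⁻¹ᶜ-inverseʳ : ∀ {z} → ¬ (z ≈ᶜ 0ℂ) → z *ᶜ z ⁻¹ᶜ ≈ᶜ 1ℂ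
  ⁻¹ᶜ-inverseʳ {z@(a +i b)} z≉0 = trans
    (solve 3 (λ a b n → a :* (a :* n) :- b :* ((:- b) :* n) := (a :* a :+ b :* b) :* n)
      refl a b (∣ z ∣² ⁻¹))
    (⁻¹-inverseʳ (0<⇒≉0 (∣z∣²-positive z≉0))) ,
    solve 3 (λ a b n → a :* ((:- b) :* n) :+ b :* (a :* n) := :0) refl a b (∣ z ∣² ⁻¹)

  inverse⇒≉0 : ∀ {z w} → z *ᶜ w ≈ᶜ 1ℂ → ¬ (z ≈ᶜ 0ℂ)
  inverse⇒≉0 {z} {w} zw≈1 z≈0 =
    0ℂ≉1ℂ (ℂ′.trans (ℂ′.sym (ℂ′.zeroˡ w)) (ℂ′.trans (ℂ′.*-congʳ {w} (ℂ′.sym z≈0)) zw≈1))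

  inverse-unique : ∀ {z w} → z *ᶜ w ≈ᶜ 1ℂ → w ≈ᶜ z ⁻¹ᶜ
  inverse-unique zw≈1 = right-inverse-unique zw≈1
    (⁻¹ᶜ-inverseʳ (inverse⇒≉0 zw≈1))

  -- The modulus is a supremum of numbers with square at most ∣z∣². This bound and the next are its
  -- two defining properties, and all passage between moduli and squares rests on them.
  ∣∣≤ : ∀ z {d} → 0# ≤ d → ∣ z ∣² ≤ d * d → ∣ z ∣ ≤ d
  ∣∣≤ z 0≤d ∣z∣²≤d² =
    proj₂ (proj₂ (sqrt-supremum 0≤∣ z ∣²)) λ t²≤ → square-cancel-≤ 0≤d (≤.trans t²≤ ∣z∣²≤d²)

  ≤∣∣ : ∀ z {d} → d * d ≤ ∣ z ∣² → d ≤ ∣ z ∣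
  ≤∣∣ z d²≤∣z∣² = proj₁ (proj₂ (sqrt-supremum 0≤∣ z ∣²)) d²≤∣z∣²

  ∣∣<⇒∣∣²≤ : ∀ z {d} → ∣ z ∣ < d → ∣ z ∣² ≤ d * d
  ∣∣<⇒∣∣²≤ z {d} ∣z∣<d with ≤.total ∣ z ∣² (d * d)
  ... | inj₁ ∣z∣²≤d² = ∣z∣²≤d²
  ... | inj₂ d²≤∣z∣² = contradiction (≤∣∣ z d²≤∣z∣²) (<⇒≱ ∣z∣<d)

  re≱⇒∈ : ∀ {a z} → ¬ (a ≤ re z) → z ∈ ℂ∖[ a ,∞⟩
  re≱⇒∈ a≰re (t , a≤t , (re≈t , _)) = a≰re (≤.trans a≤t (≤.reflexive (sym re≈t)))

  ∖-resp : ∀ {a z w} → z ≈ᶜ w → z ∈ ℂ∖[ a ,∞⟩ → w ∈ ℂ∖[ a ,∞⟩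
  ∖-resp z≈w z∉ (t , a≤t , w≈t) = z∉ (t , a≤t , ℂ′.trans z≈w w≈t)

  ∈⇒≉0 : ∀ {z} → z ∈ ℂ∖[ 0# ,∞⟩ → ¬ (z ≈ᶜ 0ℂ)
  ∈⇒≉0 z∉ z≈0 = z∉ (0# , ≤.refl , z≈0)

  ∈-‿-1 : ∀ {z} → z ∈ ℂ∖[ 1# ,∞⟩ → (z -ᶜ 1ℂ) ∈ ℂ∖[ 0# ,∞⟩
  ∈-‿-1 {a +i b} z∉ (t , 0≤t , (a-1≈t , b-0≈0)) = z∉ (t + 1# , x≤y+x 0≤t ,
    ( trans (solve 1 (λ a → a := a :- :1 :+ :1) refl a) (+-congʳ a-1≈t)
    , trans (solve 1 (λ b → b := b :- :0) refl b) b-0≈0))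

  ∖0⊆∖1 : ∀ {z} → z ∈ ℂ∖[ 0# ,∞⟩ → z ∈ ℂ∖[ 1# ,∞⟩
  ∖0⊆∖1 z∉ (t , 1≤t , z≈t) = z∉ (t , ≤.trans 0≤1 1≤t , z≈t)

  ∈-inverse : ∀ {z w} → z *ᶜ w ≈ᶜ 1ℂ → z ∈ ℂ∖[ 0# ,∞⟩ → w ∈ ℂ∖[ 0# ,∞⟩
  ∈-inverse {z} {w} zw≈1 z∉ (t , 0≤t , w≈t) = z∉ (t ⁻¹ , proj₁ (⁻¹-positive 0<t) ,
    ℂ′.trans (inverse-unique (ℂ′.trans (ℂ′.*-comm w z) zw≈1))
      (ℂ′.trans (⁻¹ᶜ-cong w≈t) (ℂ′.sym (inverse-unique
        ( trans (solve 2 (λ t n → t :* n :- :0 :* :0 := t :* n) refl t (t ⁻¹)) (⁻¹-inverseʳ t≉0)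
        , solve 2 (λ t n → t :* :0 :+ :0 :* n := :0) refl t (t ⁻¹))))))
    where
    t≉0 : ¬ (t ≈ 0#)
    t≉0 t≈0 = inverse⇒≉0 (ℂ′.trans (ℂ′.*-comm w z) zw≈1) (ℂ′.trans w≈t (t≈0 , refl))
    0<t : 0# < t
    0<t = 0≤t , λ 0≈t → t≉0 (sym 0≈t)

  -- Bounds on the left half-plane

  bound-from-quotient : ∀ {gw gz h n f′ : ℂ} {d} → h *ᶜ n ≈ᶜ 1ℂ →
    ∣ (gw -ᶜ gz) *ᶜ n -ᶜ f′ ∣² ≤ 1# → ∣ h ∣² ≤ d →
    ∣ gw ∣² ≤ 2# * (∣ gz ∣² + d * (2# * (1# + ∣ f′ ∣²)))
  bound-from-quotient {gw} {gz} {h} {n} {f′} {d} hn≈1 ∣q∣²≤1 ∣h∣²≤d = begin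
    ∣ gw ∣²                               ≈⟨ ∣∣²-cong (difference-quotient gw gz h n f′ hn≈1) ⟩
    ∣ gz +ᶜ h *ᶜ (q +ᶜ f′) ∣²             ≤⟨ ∣∣²-+ gz (h *ᶜ (q +ᶜ f′)) ⟩
    2# * (∣ gz ∣² + ∣ h *ᶜ (q +ᶜ f′) ∣²)  ≤⟨ *-monoˡ-≤ (proj₁ 0<2) (+-mono-≤ ≤.refl (begin
      ∣ h *ᶜ (q +ᶜ f′) ∣²                   ≈⟨ ∣∣²-* h (q +ᶜ f′) ⟩
      ∣ h ∣² * ∣ q +ᶜ f′ ∣²                 ≤⟨ *-mono-≤ (≤.trans 0≤∣ h ∣² ∣h∣²≤d) 0≤∣ q +ᶜ f′ ∣² ∣h∣²≤d (begin
        ∣ q +ᶜ f′ ∣²                          ≤⟨ ∣∣²-+ q f′ ⟩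
        2# * (∣ q ∣² + ∣ f′ ∣²)               ≤⟨ *-monoˡ-≤ (proj₁ 0<2) (+-mono-≤ ∣q∣²≤1 ≤.refl) ⟩
        2# * (1# + ∣ f′ ∣²)                   ∎) ⟩
      d * (2# * (1# + ∣ f′ ∣²))             ∎)) ⟩
    2# * (∣ gz ∣² + d * (2# * (1# + ∣ f′ ∣²)))  ∎
    where
    q : ℂ
    q = (gw -ᶜ gz) *ᶜ n -ᶜ f′

  ∣G∣²-cong : ∀ (G : ComplexFunction) z w → z ≈ᶜ w → ∣ G ⟨$⟩ z ∣² ≈ ∣ G ⟨$⟩ w ∣²
  ∣G∣²-cong G z w z≈w = ∣∣²-cong {G ⟨$⟩ z} {G ⟨$⟩ w} (Func.cong G {z} {w} z≈w)

  x≤2*[x+y] : ∀ {x y} → 0# ≤ x → 0# ≤ y → x ≤ 2# * (x + y)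
  x≤2*[x+y] {x} {y} 0≤x 0≤y = ≤-certificate (+-nonNegative 0≤x (*-nonNegative (proj₁ 0<2) 0≤y))
    (solve 2 (λ x y → x :+ :2 :* y := :2 :* (x :+ y) :- x) refl x y)

  -- The radius `half δ` leaves room for the strict ∣h∣ < δ. Membership is asked of z + (w - z)
  -- rather than of w because an arbitrary `D` need not respect `≈ᶜ`.
  bounded-near : ∀ {D : Pred ℂ 0ℓ} G z f′ {δ} → 0# < δ →
    (∀ h → ¬ (h ≈ᶜ 0ℂ) → (z +ᶜ h) ∈ D → ∣ h ∣ < δ →
      ∣ ((G ⟨$⟩ (z +ᶜ h)) -ᶜ (G ⟨$⟩ z)) *ᶜ h ⁻¹ᶜ -ᶜ f′ ∣ < 1#) →
    ∀ w → (z +ᶜ (w -ᶜ z)) ∈ D → ∣ w -ᶜ z ∣² ≤ half δ * half δ →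
    ∣ G ⟨$⟩ w ∣² ≤ 2# * (∣ G ⟨$⟩ z ∣² + (half δ * half δ) * (2# * (1# + ∣ f′ ∣²)))
  bounded-near G z f′ {δ} 0<δ near w w∈D ∣w-z∣²≤d² with em {(w -ᶜ z) ≈ᶜ 0ℂ}
  -- The derivative constrains only nonzero increments; here the value at the centre is bounded by
  -- itself.
  ... | yes h≈0 = ≤.trans
    (≤.reflexive (∣G∣²-cong G w z
      (ℂ′.trans (x≈y+[x-y] w z) (ℂ′.trans (ℂ′.+-congˡ h≈0) (ℂ′.+-identityʳ z)))))
    (x≤2*[x+y] 0≤∣ G ⟨$⟩ z ∣² (*-nonNegative (0≤x*x (half δ))
      (*-nonNegative (proj₁ 0<2) (+-nonNegative 0≤1 0≤∣ f′ ∣²))))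
  ... | no h≉0 = ≤.trans (≤.reflexive (∣G∣²-cong G w _ (x≈y+[x-y] w z)))
    (bound-from-quotient {gw = G ⟨$⟩ (z +ᶜ (w -ᶜ z))} {f′ = f′} (⁻¹ᶜ-inverseʳ h≉0)
      (≤.trans
        (∣∣<⇒∣∣²≤ _ (near (w -ᶜ z) h≉0 w∈D
          (≤-<-trans (∣∣≤ (w -ᶜ z) (proj₁ (half-positive 0<δ)) ∣w-z∣²≤d²) (half< 0<δ))))
        (≤.reflexive (*-identityˡ 1#)))
      ∣w-z∣²≤d²)

  locally-bounded : ∀ {D : Pred ℂ 0ℓ} G → HolomorphicOn D G → ∀ {z} → z ∈ D →
    ∃ λ d → 0# < d × ∃ λ M → ∀ w → (z +ᶜ (w -ᶜ z)) ∈ D → ∣ w -ᶜ z ∣² ≤ d * d → ∣ G ⟨$⟩ w ∣² ≤ M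
  locally-bounded {D} G holo {z} z∈D =
    let (f′ , derivative) = holo z∈D
        (δ , 0<δ , near) = derivative 0<1
    in half δ , half-positive 0<δ , _ , bounded-near {D} G z f′ 0<δ near

  -- Compactness of rectangles

  Near : Carrier → Carrier → Carrier → Set
  Near x δ s = x - δ ≤ s × s ≤ x + δ

  near-mono : ∀ {x δ ε s} → δ ≤ ε → Near x δ s → Near x ε s
  near-mono {x} {δ} {ε} {s} δ≤ε (x-δ≤s , s≤x+δ) =
    ≤-certificate (+-nonNegative 0≤ε-δ (x≤y⇒0≤y-x x-δ≤s))
      (solve 4 (λ x δ ε s → ε :- δ :+ (s :- (x :- δ)) := s :- (x :- ε)) refl x δ ε s) ,
    ≤-certificate (+-nonNegative 0≤ε-δ (x≤y⇒0≤y-x s≤x+δ))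
      (solve 4 (λ x δ ε s → ε :- δ :+ (x :+ δ :- s) := x :+ ε :- s) refl x δ ε s)
    where 0≤ε-δ = x≤y⇒0≤y-x δ≤ε

  near-square : ∀ {x δ s} → Near x δ s → (s - x) * (s - x) ≤ δ * δ
  near-square {x} {δ} {s} (x-δ≤s , s≤x+δ) =
    ≤-certificate (*-nonNegative (x≤y⇒0≤y-x x-δ≤s) (x≤y⇒0≤y-x s≤x+δ))
      (solve 3 (λ x δ s → (s :- (x :- δ)) :* (x :+ δ :- s)
                          := δ :* δ :- (s :- x) :* (s :- x)) refl x δ s)

  -- A square of half-side d/2 fits into the disc of radius d, as 2(d/2)² ≤ d². Squares suit an
  -- induction on one coordinate at a time.
  near-∣∣² : ∀ {z w d} → 0# ≤ d → Near (re z) (half d) (re w) → Near (im z) (half d) (im w) →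
    ∣ w -ᶜ z ∣² ≤ d * d
  near-∣∣² {z} {w} {d} 0≤d near-re near-im = begin
    ∣ w -ᶜ z ∣²                            ≤⟨ +-mono-≤ (near-square near-re) (near-square near-im) ⟩
    half d * half d + half d * half d      ≈⟨ distribˡ _ _ _ ⟨
    half d * (half d + half d)             ≈⟨ *-congˡ (half+half d) ⟩
    half d * d                             ≈⟨ *-comm _ _ ⟩
    d * half d                             ≤⟨ *-monoˡ-≤ 0≤d (half≤ 0≤d) ⟩
    d * d                                  ∎

  re≤0⇒∈ : ∀ {z} → re z ≤ 0# → z ∈ ℂ∖[ 1# ,∞⟩
  re≤0⇒∈ re≤0 = re≱⇒∈ λ 1≤re → <⇒≱ 0<1 (≤.trans 1≤re re≤0)

  -- The tube lemma: an interval induction along each vertical segment yields a slab of some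
  -- positive width, and a second one across the real parts joins the slabs.
  bounded-on-rectangles : ∀ G → HolomorphicOn ℂ∖[ 1# ,∞⟩ G → ∀ {a b} → 0# ≤ a → 0# ≤ b →
    ∃ λ M → ∀ w → - a ≤ re w → re w ≤ 0# → - b ≤ im w → im w ≤ b → ∣ G ⟨$⟩ w ∣² ≤ M
  bounded-on-rectangles G holo {a} {b} 0≤a 0≤b = let (M , bound) = rectangle in
    M , λ w -a≤re re≤0 → bound w re≤0 -a≤re re≤0
    where
    -c≤0 : ∀ {c} → 0# ≤ c → - c ≤ 0#
    -c≤0 {c} 0≤c = ≤-certificate 0≤c (solve 1 (λ c → c := :0 :- (:- c)) refl c)

    -- The width is existential because gluing has to pass to the smaller of two widths. The slab is
    -- cut at re w ≤ 0 because around x = 0 it would spill into the right half-plane.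
    BoundedOnSlab : Carrier → Carrier → Carrier → Set
    BoundedOnSlab x s t = ∃ λ δ → 0# < δ × ∃ λ M → ∀ w → re w ≤ 0# →
      Near x δ (re w) → s ≤ im w → im w ≤ t → ∣ G ⟨$⟩ w ∣² ≤ M

    BoundedOnStrip : Carrier → Carrier → Set
    BoundedOnStrip s t = ∃ λ M → ∀ w → re w ≤ 0# →
      s ≤ re w → re w ≤ t → - b ≤ im w → im w ≤ b → ∣ G ⟨$⟩ w ∣² ≤ M

    slab-glue : ∀ {x s t u} → s ≤ t → t ≤ u →
      BoundedOnSlab x s t → BoundedOnSlab x t u → BoundedOnSlab x s u
    slab-glue {x} {s} {t} {u} _ _ (δ₁ , 0<δ₁ , M₁ , bound₁) (δ₂ , 0<δ₂ , M₂ , bound₂)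
      with common-positive-lower-bound 0<δ₁ 0<δ₂ | common-upper-bound M₁ M₂
    ... | δ , 0<δ , δ≤δ₁ , δ≤δ₂ | M , M₁≤M , M₂≤M = δ , 0<δ , M , bound
      where
      bound : ∀ w → re w ≤ 0# → Near x δ (re w) → s ≤ im w → im w ≤ u → ∣ G ⟨$⟩ w ∣² ≤ M
      bound w re≤0 near s≤im im≤u with ≤.total (im w) t
      ... | inj₁ im≤t = ≤.trans (bound₁ w re≤0 (near-mono δ≤δ₁ near) s≤im im≤t) M₁≤M
      ... | inj₂ t≤im = ≤.trans (bound₂ w re≤0 (near-mono δ≤δ₂ near) t≤im im≤u) M₂≤M

    slab : ∀ {x} → x ≤ 0# → BoundedOnSlab x (- b) b
    slab {x} x≤0 = interval-induction (BoundedOnSlab x) slab-glue (≤.trans (-c≤0 0≤b) 0≤b) local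
      where
      local : ∀ {y} → - b ≤ y → y ≤ b → ∃ λ δ → 0# < δ ×
        (∀ {s t} → - b ≤ s → s ≤ y → y ≤ t → t ≤ b → y - δ ≤ s → t ≤ y + δ → BoundedOnSlab x s t)
      local {y} _ _ =
        let z = x +i y
            (d , 0<d , M , bound) = locally-bounded {ℂ∖[ 1# ,∞⟩} G holo {z} (re≤0⇒∈ {z} x≤0)
        in half d , half-positive 0<d ,
          λ _ _ _ _ y-δ≤s t≤y+δ → half d , half-positive 0<d , M ,
            λ w re≤0 near s≤im im≤t → bound w
              (∖-resp {1#} {w} {z +ᶜ (w -ᶜ z)} (x≈y+[x-y] w z) (re≤0⇒∈ {w} re≤0))
              (near-∣∣² {z} {w} (proj₁ 0<d) near (≤.trans y-δ≤s s≤im , ≤.trans im≤t t≤y+δ))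

    strip-glue : ∀ {s t u} → s ≤ t → t ≤ u →
      BoundedOnStrip s t → BoundedOnStrip t u → BoundedOnStrip s u
    strip-glue {s} {t} {u} _ _ (M₁ , bound₁) (M₂ , bound₂) with common-upper-bound M₁ M₂
    ... | M , M₁≤M , M₂≤M = M , bound
      where
      bound : ∀ w → re w ≤ 0# → s ≤ re w → re w ≤ u → - b ≤ im w → im w ≤ b → ∣ G ⟨$⟩ w ∣² ≤ M
      bound w re≤0 s≤re re≤u -b≤im im≤b with ≤.total (re w) t
      ... | inj₁ re≤t = ≤.trans (bound₁ w re≤0 s≤re re≤t -b≤im im≤b) M₁≤M
      ... | inj₂ t≤re = ≤.trans (bound₂ w re≤0 t≤re re≤u -b≤im im≤b) M₂≤M

    rectangle : BoundedOnStrip (- a) 0#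
    rectangle = interval-induction BoundedOnStrip strip-glue (-c≤0 0≤a) λ _ x≤0 →
      let (δ , 0<δ , M , bound) = slab x≤0 in
      δ , 0<δ , λ _ _ _ _ x-δ≤s t≤x+δ → M ,
        λ w re≤0 s≤re re≤t → bound w re≤0 (≤.trans x-δ≤s s≤re , ≤.trans re≤t t≤x+δ)

  -- Decay on the left half-plane

  VanishesOnLeft : (ℂ → Carrier) → Set
  VanishesOnLeft g = ∀ {ε} → 0# < ε → ∃ λ K → 0# ≤ K ×
    (∀ w → re w ≤ 0# → K * K ≤ ∣ w ∣² → g w ≤ ε)

  x≤-y≤0⇒y²≤s : ∀ {x y s} → 0# ≤ y → x ≤ - y → x * x ≤ s → y * y ≤ s
  x≤-y≤0⇒y²≤s {x} {y} 0≤y x≤-y x²≤s = ≤.trans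
    (≤.trans (*-mono-≤ (≤.trans 0≤y y≤-x) 0≤y y≤-x y≤-x)
      (≤.reflexive (solve 1 (λ x → (:- x) :* (:- x) := x :* x) refl x)))
    x²≤s
    where
    y≤-x : y ≤ - x
    y≤-x = ≤-certificate (x≤y⇒0≤y-x x≤-y) (solve 2 (λ x y → (:- y) :- x := (:- x) :- y) refl x y)

  -- For re w ≤ 0 and t ≥ 0, ∣w - t∣² exceeds ∣w∣² by t² - 2t re w ≥ 0, so w is at least ∣w∣ away
  -- from the ray.
  vanishes-on-left : ∀ {G} → VanishesFarFromℝ₊ G → VanishesOnLeft λ w → ∣ G ⟨$⟩ w ∣²
  vanishes-on-left {G} vanishes 0<ε =
    let (e , 0<e , e²≤ε)    = positive-square-below 0<ε
        (K₀ , small)         = vanishes 0<e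
        -- The extra 1 makes the distance strictly larger than `K₀`.
        (K , K₀+1≤K , 0≤K)  = common-upper-bound (K₀ + 1#) 0#
    in K , 0≤K , λ w re≤0 K²≤∣w∣² → ≤.trans
      (∣∣<⇒∣∣²≤ (G ⟨$⟩ w) (small {w} (re≤0⇒∈ {w} re≤0)
        (<-≤-trans (x+1≤y⇒x<y K₀+1≤K) (far w re≤0 K²≤∣w∣²))))
      e²≤ε
    where
    x+1≤y⇒x<y : ∀ {x y} → x + 1# ≤ y → x < y
    x+1≤y⇒x<y {x} {y} x+1≤y = ≰⇒> λ y≤x → <⇒≱ 0<1 (≤-certificate (x≤y⇒0≤y-x (≤.trans x+1≤y y≤x))
      (solve 1 (λ x → x :- (x :+ :1) := :0 :- :1) refl x))

    far : ∀ {K} w → re w ≤ 0# → K * K ≤ ∣ w ∣² → K ≤ dist[ w ,ℝ₊]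
    far w@(a +i b) a≤0 K²≤∣w∣² = proj₁ (proj₂ (dist-supremum w)) λ {t} 0≤t →
      ≤∣∣ (w -ᶜ ofReal t) (≤.trans K²≤∣w∣² (≤-certificate
        (+-nonNegative (0≤x*x t)
          (*-nonNegative (proj₁ 0<2) (*-nonNegative (x≤0⇒0≤-x a≤0) 0≤t)))
        (solve 3 (λ a b t → t :* t :+ :2 :* ((:- a) :* t)
          := (a :- t) :* (a :- t) :+ (b :- :0) :* (b :- :0) :- (a :* a :+ b :* b)) refl a b t)))

  bounded-on-left : ∀ G → HolomorphicOn ℂ∖[ 1# ,∞⟩ G → VanishesFarFromℝ₊ G →
    ∃ λ M → ∀ w → re w ≤ 0# → ∣ G ⟨$⟩ w ∣² ≤ M
  bounded-on-left G holo vanishes =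
    let (K , 0≤K , far)          = vanishes-on-left {G} vanishes 0<1
        (M₀ , near)              = bounded-on-rectangles G holo 0≤K 0≤K
        (M , M₀≤M , 1≤M)         = common-upper-bound M₀ 1#
    in M , λ w re≤0 → by-cases 0≤K w
      (λ -K≤re -K≤im im≤K → ≤.trans (near w -K≤re re≤0 -K≤im im≤K) M₀≤M)
      (λ K²≤∣w∣² → ≤.trans (far w re≤0 K²≤∣w∣²) 1≤M)
    where
    outside : ∀ {K x s} → 0# ≤ K → K ≤ x → x * x ≤ s → K * K ≤ s
    outside 0≤K K≤x x²≤s = ≤.trans (*-mono-≤ (≤.trans 0≤K K≤x) 0≤K K≤x K≤x) x²≤s

    by-cases : ∀ {K} {A : Set} → 0# ≤ K → ∀ w →
      (- K ≤ re w → - K ≤ im w → im w ≤ K → A) → (K * K ≤ ∣ w ∣² → A) → A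
    by-cases {K} 0≤K w inside far
      with ≤.total (- K) (re w) | ≤.total (- K) (im w) | ≤.total (im w) K
    ... | inj₁ -K≤re | inj₁ -K≤im | inj₁ im≤K = inside -K≤re -K≤im im≤K
    ... | inj₂ re≤-K | _ | _ = far (x≤-y≤0⇒y²≤s 0≤K re≤-K (re²≤∣∣² w))
    ... | inj₁ _ | inj₂ im≤-K | _ = far (x≤-y≤0⇒y²≤s 0≤K im≤-K (im²≤∣∣² w))
    ... | inj₁ _ | inj₁ _ | inj₂ K≤im = far (outside 0≤K K≤im (im²≤∣∣² w))

  -- A maximum principle for averages

  -- If the supremum M were positive, decay would keep g below M - M/2 far to the left. In the mean
  -- one of the two points lies a unit further left and the other value is at most M, so a deficit c
  -- there becomes c/2 here. At the imaginary axis a positive deficit contradicts the leastness of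
  -- M.
  no-positive-maximum : (g : ℂ → Carrier) →
    (∃ λ B → ∀ w → re w ≤ 0# → g w ≤ B) → VanishesOnLeft g →
    (∀ w → re w ≤ 0# → ∃ λ u → ∃ λ v → re u ≤ re w - 1# × re v ≤ 0# × g w + g w ≤ g u + g v) →
    ∀ w → re w ≤ 0# → g w ≤ 0#
  no-positive-maximum g (B , bounded) vanishes average w re≤0 = ≤.trans (g≤M w re≤0) (≮⇒≥ M≯0)
    where
    sup : ∃ (IsSupremum _≤_ (λ x → ∃ λ w → re w ≤ 0# × x ≤ g w))
    sup = supremum _ (g 0ℂ , 0ℂ , ≤.refl , ≤.refl)
      (B , λ (w , re≤0 , x≤gw) → ≤.trans x≤gw (bounded w re≤0))

    M : Carrier
    M = proj₁ sup

    upper = proj₁ (proj₂ sup)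
    least = proj₂ (proj₂ sup)

    g≤M : ∀ w → re w ≤ 0# → g w ≤ M
    g≤M w re≤0 = upper (w , re≤0 , ≤.refl)

    -- The deficit is existential and may shrink with t: no fixed one survives the halving.
    StrictlyBelowM : Carrier → Set
    StrictlyBelowM t = ∃ λ c → 0# < c × (∀ w → re w ≤ 0# → re w ≤ - t → g w ≤ M - c)

    move-right : ∀ {s t} → 0# ≤ s → t ≤ s + 1# → StrictlyBelowM t → StrictlyBelowM s
    move-right {s} {t} 0≤s t≤s+1 (c , 0<c , below) = half c , half-positive 0<c , λ w re≤0 re≤-s →
      let (u , v , re-u≤ , re-v≤0 , mean) = average w re≤0
          re-u≤-t = ≤.trans re-u≤ (≤-certificate (+-nonNegative (x≤y⇒0≤y-x re≤-s) (x≤y⇒0≤y-x t≤s+1))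
            (solve 3 (λ r s t → (:- s) :- r :+ (s :+ :1 :- t) := (:- t) :- (r :- :1))
              refl (re w) s t))
          re-u≤0 = ≤.trans re-u≤ (≤-certificate (+-nonNegative (x≤y⇒0≤y-x re≤0) 0≤1)
            (solve 1 (λ r → :0 :- r :+ :1 := :0 :- (r :- :1)) refl (re w)))
      in *-cancelˡ-≤ 0<2 (begin
        2# * g w                ≈⟨ solve 1 (λ g → :2 :* g := g :+ g) refl (g w) ⟩
        g w + g w               ≤⟨ mean ⟩
        g u + g v               ≤⟨ +-mono-≤ (below u re-u≤0 re-u≤-t) (g≤M v re-v≤0) ⟩
        M - c + M               ≈⟨ +-congʳ (+-congˡ (-‿cong (half+half c))) ⟨
        M - (half c + half c) + M
          ≈⟨ solve 2 (λ m h → m :- (h :+ h) :+ m := :2 :* (m :- h)) refl M (half c) ⟩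
        2# * (M - half c)       ∎)

    M≯0 : ¬ (0# < M)
    M≯0 0<M = let (K , 0≤K , far) = vanishes (half-positive 0<M) in
      -- The relation is an implication from the right end to the left end, so gluing is composition
      -- and the deficit travels from `K` down to 0.
      not-below-0 (interval-induction (λ s t → StrictlyBelowM t → StrictlyBelowM s)
        (λ _ _ f g x → f (g x)) 0≤K local
        (half M , half-positive 0<M , λ w re≤0 re≤-K → ≤.trans
          (far w re≤0 (x≤-y≤0⇒y²≤s 0≤K re≤-K (re²≤∣∣² w)))
          (≤.reflexive (trans (solve 1 (λ h → h := h :+ h :- h) refl (half M))
            (+-congʳ (half+half M))))))
      where
      local : ∀ {K x} → 0# ≤ x → x ≤ K → ∃ λ δ → 0# < δ × (∀ {s t} → 0# ≤ s → s ≤ x → x ≤ t → t ≤ K →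
        x - δ ≤ s → t ≤ x + δ → StrictlyBelowM t → StrictlyBelowM s)
      local {x = x} _ _ = half 1# , half-positive 0<1 , λ {s} {t} 0≤s _ _ _ x-δ≤s t≤x+δ →
        move-right 0≤s (near⇒≤+1 x-δ≤s t≤x+δ)

      not-below-0 : ¬ StrictlyBelowM 0#
      not-below-0 (c , 0<c , below) = <⇒≱ 0<c (≤-certificate (x≤y⇒0≤y-x M≤M-c)
        (solve 2 (λ m c → m :- c :- m := :0 :- c) refl M c))
        where
        M≤M-c : M ≤ M - c
        M≤M-c = least λ (w , re≤0 , x≤gw) → ≤.trans x≤gw (below w re≤0
          (≤.trans re≤0 (≤.reflexive (solve 0 (:0 := :- :0) refl))))

  -- Repeated application of v ↦ v − 1 and v ↦ 1/v − 1 is the Euclidean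
  -- algorithm; it keeps no non-real number in the right half-plane, since the
  -- bounded quantity (im v)² / ∣ v ∣² at least doubles between an inversion in the
  -- unit disc and the return to it.
  module EuclideanAlgorithm (A : Pred ℂ 0ℓ) (A⊆ : ∀ {v} → A v → v ∈ ℂ∖[ 0# ,∞⟩)
    (0<re : ∀ {v} → A v → 0# < re v)
    (step : ∀ {v} → A v → A (v -ᶜ 1ℂ) ⊎ A (v ⁻¹ᶜ -ᶜ 1ℂ))
    where

    -- The real part of 1/v - 1 is re v / ∣v∣² - 1, and it is positive. Geometrically, v lies in the
    -- disc with diameter [0, 1].
    ∣v∣²≤re : ∀ {v} → A v → A (v ⁻¹ᶜ -ᶜ 1ℂ) → ∣ v ∣² ≤ re v
    ∣v∣²≤re {v} v∈A u∈A = begin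
      ∣ v ∣²                         ≈⟨ *-identityʳ _ ⟨
      ∣ v ∣² * 1#                    ≤⟨ *-monoˡ-≤ 0≤∣ v ∣² (0≤y-x⇒x≤y (proj₁ (0<re u∈A))) ⟩
      ∣ v ∣² * (re v * ∣ v ∣² ⁻¹)    ≈⟨ solve 3 (λ n a i → n :* (a :* i) := a :* (n :* i))
                                         refl ∣ v ∣² (re v) (∣ v ∣² ⁻¹) ⟩
      re v * (∣ v ∣² * ∣ v ∣² ⁻¹)    ≈⟨ *-congˡ (⁻¹-inverseʳ (0<⇒≉0 (∣z∣²-positive {v} (∈⇒≉0 {v} (A⊆ v∈A))))) ⟩
      re v * 1#                      ≈⟨ *-identityʳ _ ⟩
      re v                           ∎

    -- The other alternative would put v into the disc with diameter [0, 1], which lies in the unit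
    -- disc.
    subtract-outside-disc : ∀ {v} → A v → ¬ (∣ v ∣² ≤ 1#) → A (v -ᶜ 1ℂ)
    subtract-outside-disc {v} v∈A ∣v∣²≰1 with step {v} v∈A
    ... | inj₁ v-1∈A = v-1∈A
    ... | inj₂ u∈A   = contradiction (≤.trans ∣v∣²≤re-v re≤1) ∣v∣²≰1
      where
      ∣v∣²≤re-v : ∣ v ∣² ≤ re v
      ∣v∣²≤re-v = ∣v∣²≤re {v} v∈A u∈A
      re≤1 : re v ≤ 1#
      re≤1 = *-cancelˡ-≤ (0<re v∈A)
        (≤.trans (re²≤∣∣² v) (≤.trans ∣v∣²≤re-v (≤.reflexive (sym (*-identityʳ (re v))))))

    -- The other alternative forces re v > 1. So the position relative to the unit disc decides
    -- which step is taken.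
    invert-inside-disc : ∀ {v} → A v → ∣ v ∣² ≤ 1# → A (v ⁻¹ᶜ -ᶜ 1ℂ)
    invert-inside-disc {v} v∈A ∣v∣²≤1 with step {v} v∈A
    ... | inj₂ u∈A   = u∈A
    ... | inj₁ v-1∈A = contradiction re≤1 (<⇒≱ 1<re)
      where
      1<re : 1# < re v
      1<re = ≰⇒> λ re≤1 → <⇒≱ (0<re v-1∈A) (≤-certificate (x≤y⇒0≤y-x re≤1)
        (solve 1 (λ a → :1 :- a := :0 :- (a :- :1)) refl (re v)))
      re≤1 : re v ≤ 1#
      re≤1 = ≤.trans (1≤x⇒x≤x*x (proj₁ 1<re)) (≤.trans (re²≤∣∣² v) ∣v∣²≤1)

    -- The last two clauses are what the quotient (im v)² / ∣v∣² needs: subtractions keep its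
    -- numerator and do not increase its denominator.
    ReachesDisc : ℂ → Set
    ReachesDisc u = ∃ λ v → A v × ∣ v ∣² ≤ 1# × ∣ v ∣² ≤ ∣ u ∣² × im v ≈ im u

    reaches-disc : ∀ {u} → A u → ReachesDisc u
    reaches-disc {u} u∈A = interval-induction
      (λ s t → UpTo s → UpTo t) (λ _ _ f g x → g (f x)) (proj₁ (0<re u∈A)) local
      -- The start at 0 is vacuous, since real parts in `A` are positive.
      (λ v v∈A re≤0 → contradiction re≤0 (<⇒≱ (0<re v∈A)))
      u u∈A ≤.refl
      where
      UpTo : Carrier → Set
      UpTo t = ∀ v → A v → re v ≤ t → ReachesDisc v

      extend : ∀ {s t} → t ≤ s + 1# → UpTo s → UpTo t
      extend {s} {t} t≤s+1 up-to-s v v∈A re≤t with em {∣ v ∣² ≤ 1#}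
      ... | yes ∣v∣²≤1 = v , v∈A , ∣v∣²≤1 , ≤.refl , refl
      ... | no ∣v∣²≰1  =
        let v-1∈A = subtract-outside-disc {v} v∈A ∣v∣²≰1
            (w , w∈A , ∣w∣²≤1 , ∣w∣²≤ , im-w≈) = up-to-s (v -ᶜ 1ℂ) v-1∈A
              (≤-certificate (x≤y⇒0≤y-x (≤.trans re≤t t≤s+1))
                (solve 2 (λ a s → s :+ :1 :- a := s :- (a :- :1)) refl (re v) s))
        in w , w∈A , ∣w∣²≤1 ,
          -- ∣v∣² - ∣v - 1∣² = 2(re v - 1) + 1, and re v - 1 > 0 because v - 1 lies in `A`.
          ≤.trans ∣w∣²≤ (≤-certificate
            (+-nonNegative (*-nonNegative (proj₁ 0<2) (proj₁ (0<re v-1∈A))) 0≤1)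
            (solve 2 (λ a b → :2 :* (a :- :1) :+ :1
              := (a :* a :+ b :* b) :- ((a :- :1) :* (a :- :1) :+ (b :- :0) :* (b :- :0)))
              refl (re v) (im v))) ,
          trans im-w≈ (solve 1 (λ b → b :- :0 := b) refl (im v))

      local : ∀ {x} → 0# ≤ x → x ≤ re u → ∃ λ δ → 0# < δ × (∀ {s t} →
        0# ≤ s → s ≤ x → x ≤ t → t ≤ re u → x - δ ≤ s → t ≤ x + δ → UpTo s → UpTo t)
      local {x} _ _ = half 1# , half-positive 0<1 , λ {s} {t} _ _ _ _ x-δ≤s t≤x+δ →
        extend (near⇒≤+1 x-δ≤s t≤x+δ)

    -- The lower bounds, free of division, for the squared sine of the argument of some member of
    -- `A` in the unit disc.
    Slope : Carrier → Set
    Slope σ = 0# ≤ σ × ∃ λ v → A v × ∣ v ∣² ≤ 1# × σ * ∣ v ∣² ≤ im v * im v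

    ∣v∣²-positive : ∀ {v} → A v → 0# < ∣ v ∣²
    ∣v∣²-positive {v} v∈A = ∣z∣²-positive {v} (∈⇒≉0 {v} (A⊆ v∈A))

    slope≤1 : ∀ {σ} → Slope σ → σ ≤ 1#
    slope≤1 {σ} (_ , v , v∈A , _ , σ∣v∣²≤im²) = *-cancelˡ-≤ (∣v∣²-positive {v} v∈A)
      (≤.trans (≤.reflexive (*-comm _ _))
        (≤.trans σ∣v∣²≤im² (≤.trans (im²≤∣∣² v) (≤.reflexive (sym (*-identityʳ _))))))

    -- With u = 1/v − 1 one has ∣u∣² ∣v∣² = ∣1 − v∣² and ∣v∣² + ∣1 − v∣² ≤ 1, so one of
    -- ∣v∣² and ∣1 − v∣² is at most 1/2.
    2∣w∣²∣v∣²≤1 : ∀ {v w} → A v → ∣ v ∣² ≤ re v → ∣ w ∣² ≤ 1# → ∣ w ∣² ≤ ∣ v ⁻¹ᶜ -ᶜ 1ℂ ∣² →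
      2# * (∣ w ∣² * ∣ v ∣²) ≤ 1#
    2∣w∣²∣v∣²≤1 {v} {w} v∈A ∣v∣²≤re-v ∣w∣²≤1 ∣w∣²≤∣u∣² = by-cases (≤.total (2# * ∣ v ∣²) 1#)
      where
      1-v : ℂ
      1-v = 1ℂ -ᶜ v

      sum≤1 : ∣ v ∣² + ∣ 1-v ∣² ≤ 1#
      sum≤1 = ≤-certificate (*-nonNegative (proj₁ 0<2) (x≤y⇒0≤y-x ∣v∣²≤re-v))
        (solve 2 (λ a b → :2 :* (a :- (a :* a :+ b :* b))
          := :1 :- ((a :* a :+ b :* b) :+ ((:1 :- a) :* (:1 :- a) :+ (:0 :- b) :* (:0 :- b))))
          refl (re v) (im v))

      ∣u∣²∣v∣²≈ : ∣ v ⁻¹ᶜ -ᶜ 1ℂ ∣² * ∣ v ∣² ≈ ∣ 1-v ∣²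
      ∣u∣²∣v∣²≈ = trans (sym (∣∣²-* (v ⁻¹ᶜ -ᶜ 1ℂ) v))
        (∣∣²-cong {(v ⁻¹ᶜ -ᶜ 1ℂ) *ᶜ v} {1-v}
          ([r-1]*z≈1-z {v} {v ⁻¹ᶜ} (⁻¹ᶜ-inverseʳ (∈⇒≉0 {v} (A⊆ v∈A)))))

      by-cases : 2# * ∣ v ∣² ≤ 1# ⊎ 1# ≤ 2# * ∣ v ∣² → 2# * (∣ w ∣² * ∣ v ∣²) ≤ 1#
      by-cases (inj₁ 2∣v∣²≤1) = ≤.trans
        (*-monoˡ-≤ (proj₁ 0<2) (*-mono-≤ 0≤1 0≤∣ v ∣² ∣w∣²≤1 ≤.refl))
        (≤.trans (≤.reflexive (*-congˡ (*-identityˡ _))) 2∣v∣²≤1)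
      by-cases (inj₂ 1≤2∣v∣²) = begin
        2# * (∣ w ∣² * ∣ v ∣²)             ≤⟨ *-monoˡ-≤ (proj₁ 0<2)
          (*-mono-≤ 0≤∣ v ⁻¹ᶜ -ᶜ 1ℂ ∣² 0≤∣ v ∣² ∣w∣²≤∣u∣² ≤.refl) ⟩
        2# * (∣ v ⁻¹ᶜ -ᶜ 1ℂ ∣² * ∣ v ∣²)   ≈⟨ *-congˡ ∣u∣²∣v∣²≈ ⟩
        2# * ∣ 1-v ∣²                      ≤⟨ ≤-certificate
          (+-nonNegative (x≤y⇒0≤y-x 1≤2∣v∣²) (*-nonNegative (proj₁ 0<2) (x≤y⇒0≤y-x sum≤1)))
          (solve 2 (λ m n → :2 :* m :- :1 :+ :2 :* (:1 :- (m :+ n)) := :1 :- :2 :* n)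
            refl ∣ v ∣² ∣ 1-v ∣²) ⟩
        1#                                 ∎

    -- Inversion gives imaginary part -im v / ∣v∣², and the return to the disc at w keeps it. Thus
    -- (im w)² / ∣w∣² is (im v)² / ∣v∣² divided by ∣v∣² ∣w∣², which is at most 1/2.
    slope-doubles : ∀ {σ} → Slope σ → Slope (σ + σ)
    slope-doubles {σ} (0≤σ , v , v∈A , ∣v∣²≤1 , σ∣v∣²≤im²) =
      let u∈A = invert-inside-disc {v} v∈A ∣v∣²≤1
          (w , w∈A , ∣w∣²≤1 , ∣w∣²≤∣u∣² , im-w≈) = reaches-disc {v ⁻¹ᶜ -ᶜ 1ℂ} u∈A
          m = ∣ w ∣²
          b = im v
      in +-nonNegative 0≤σ 0≤σ , w , w∈A , ∣w∣²≤1 , (begin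
        (σ + σ) * m
          ≈⟨ *-identityʳ _ ⟨
        (σ + σ) * m * 1#
          ≈⟨ *-congˡ (trans (*-cong nn⁻¹≈1 nn⁻¹≈1) (*-identityˡ 1#)) ⟨
        (σ + σ) * m * (n * n ⁻¹ * (n * n ⁻¹))
          ≈⟨ solve 4 (λ σ m n i → (σ :+ σ) :* m :* (n :* i :* (n :* i))
               := i :* i :* (:2 :* (m :* n) :* (σ :* n))) refl σ m n (n ⁻¹) ⟩
        n ⁻¹ * n ⁻¹ * (2# * (m * n) * (σ * n))
          ≤⟨ *-monoˡ-≤ (0≤x*x (n ⁻¹)) (*-mono-≤ 0≤1 (*-nonNegative 0≤σ 0≤∣ v ∣²)
               (2∣w∣²∣v∣²≤1 {v} {w} v∈A (∣v∣²≤re {v} v∈A u∈A) ∣w∣²≤1 ∣w∣²≤∣u∣²) σ∣v∣²≤im²) ⟩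
        n ⁻¹ * n ⁻¹ * (1# * (b * b))
          ≈⟨ solve 2 (λ b i → i :* i :* (:1 :* (b :* b))
               := ((:- b) :* i :- :0) :* ((:- b) :* i :- :0)) refl b (n ⁻¹) ⟩
        ((- b) * n ⁻¹ - 0#) * ((- b) * n ⁻¹ - 0#)
          ≈⟨ *-cong im-w≈ im-w≈ ⟨
        im w * im w ∎)
      where
      n : Carrier
      n = ∣ v ∣²

      nn⁻¹≈1 : n * n ⁻¹ ≈ 1#
      nn⁻¹≈1 = ⁻¹-inverseʳ (0<⇒≉0 (∣v∣²-positive {v} v∈A))

    positive-slope : ∀ {v} → A v → ∃ λ σ → 0# < σ × Slope σ
    positive-slope {u} u∈A =
      let (v , v∈A , ∣v∣²≤1 , _) = reaches-disc {u} u∈A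
          n = ∣ v ∣²
          0<n = ∣v∣²-positive {v} v∈A
          -- A real v with re v > 0 would lie on the excluded ray.
          im≉0 = λ im≈0 → A⊆ v∈A (re v , proj₁ (0<re v∈A) , (refl , im≈0))
          0<σ = *-positive (0<x*x im≉0) (⁻¹-positive 0<n)
      in im v * im v * n ⁻¹ , 0<σ , proj₁ 0<σ , v , v∈A , ∣v∣²≤1 , ≤.reflexive (trans
        (solve 3 (λ b n i → b :* i :* n := b :* (n :* i)) refl (im v * im v) n (n ⁻¹))
        (trans (*-congˡ (⁻¹-inverseʳ (0<⇒≉0 0<n))) (*-identityʳ _)))
      where
      0<x*x : ∀ {x} → ¬ (x ≈ 0#) → 0# < x * x
      0<x*x x≉0 = ≰⇒> λ x*x≤0 → x≉0 (x*x≤0⇒x≈0 x*x≤0)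

    -- Slopes are bounded by 1 and closed under doubling, so half their supremum is again an upper
    -- bound; a positive slope makes that absurd.
    empty : ∀ {v} → ¬ A v
    empty {v} v∈A =
      let (σ , 0<σ , σ-slope)   = positive-slope {v} v∈A
          (S , upper , least)   = supremum Slope (σ , σ-slope) (1# , slope≤1)
      in <⇒≱ (half< (<-≤-trans 0<σ (upper σ-slope)))
        (least λ {τ} τ-slope → *-cancelˡ-≤ 0<2 (begin
          2# * τ            ≈⟨ solve 1 (λ τ → :2 :* τ := τ :+ τ) refl τ ⟩
          τ + τ             ≤⟨ upper (slope-doubles τ-slope) ⟩
          S                 ≈⟨ half+half S ⟨
          half S + half S   ≈⟨ solve 1 (λ h → h :+ h := :2 :* h) refl (half S) ⟩
          2# * half S       ∎))

  -- The difference of two solutions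

  ∣1∣²≈1 : ∣ 1ℂ ∣² ≈ 1#
  ∣1∣²≈1 = solve 0 (:1 :* :1 :+ :0 :* :0 := :1) refl

  2ℂ-cancel : ∀ {x} → (2ℂ *ᶜ x) ≈ᶜ 0ℂ → x ≈ᶜ 0ℂ
  2ℂ-cancel {a +i b} (p , q) =
    *-zero-product (0<⇒≉0 0<2) (trans (solve 2 (λ a b → :2 :* a := :2 :* a :- :0 :* b) refl a b) p) ,
    *-zero-product (0<⇒≉0 0<2) (trans (solve 2 (λ a b → :2 :* b := :2 :* b :+ :0 :* a) refl a b) q)

  ∣2z∣² : ∀ z → ∣ 2ℂ *ᶜ z ∣² ≈ 2# * (2# * ∣ z ∣²)
  ∣2z∣² (a +i b) = solve 2 (λ a b →
    (:2 :* a :- :0 :* b) :* (:2 :* a :- :0 :* b) :+ (:2 :* b :+ :0 :* a) :* (:2 :* b :+ :0 :* a)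
    := :2 :* (:2 :* (a :* a :+ b :* b))) refl a b

  ∣⁻¹∣²-inverse : ∀ {z} → ¬ (z ≈ᶜ 0ℂ) → ∣ z ∣² * ∣ z ⁻¹ᶜ ∣² ≈ 1#
  ∣⁻¹∣²-inverse {z} z≉0 = trans (sym (∣∣²-* z (z ⁻¹ᶜ)))
    (trans (∣∣²-cong {z *ᶜ z ⁻¹ᶜ} {1ℂ} (⁻¹ᶜ-inverseʳ z≉0)) ∣1∣²≈1)

  ∣⁻¹∣²≤1 : ∀ {z} → ¬ (z ≈ᶜ 0ℂ) → 1# ≤ ∣ z ∣² → ∣ z ⁻¹ᶜ ∣² ≤ 1#
  ∣⁻¹∣²≤1 {z} z≉0 1≤∣z∣² = begin
    ∣ z ⁻¹ᶜ ∣²            ≈⟨ *-identityˡ _ ⟨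
    1# * ∣ z ⁻¹ᶜ ∣²       ≤⟨ *-mono-≤ (0≤∣ z ∣²) 0≤∣ z ⁻¹ᶜ ∣² 1≤∣z∣² ≤.refl ⟩
    ∣ z ∣² * ∣ z ⁻¹ᶜ ∣²   ≈⟨ ∣⁻¹∣²-inverse {z} z≉0 ⟩
    1#                    ∎

  re-⁻¹≤0 : ∀ {z} → ¬ (z ≈ᶜ 0ℂ) → re z ≤ 0# → re (z ⁻¹ᶜ) ≤ 0#
  re-⁻¹≤0 {z} z≉0 re≤0 = ≤-certificate
    (*-nonNegative (x≤0⇒0≤-x re≤0) (proj₁ (⁻¹-positive (∣z∣²-positive {z} z≉0))))
    (solve 2 (λ a n → (:- a) :* n := :0 :- a :* n) refl (re z) (∣ z ∣² ⁻¹))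

  module _ (G₁ G₂ : ComplexFunction)
    (holo₁ : HolomorphicOn ℂ∖[ 1# ,∞⟩ G₁) (holo₂ : HolomorphicOn ℂ∖[ 1# ,∞⟩ G₂)
    (three₁ : ThreeTermEquation G₁) (three₂ : ThreeTermEquation G₂)
    (sym₁ : SymmetryEquation G₁) (sym₂ : SymmetryEquation G₂)
    (vanishes₁ : VanishesFarFromℝ₊ G₁) (vanishes₂ : VanishesFarFromℝ₊ G₂)
    where

    Δ : ℂ → ℂ
    Δ z = (G₁ ⟨$⟩ z) -ᶜ (G₂ ⟨$⟩ z)

    Δ-cong : ∀ z w → z ≈ᶜ w → Δ z ≈ᶜ Δ w
    Δ-cong z w z≈w = ℂ′.+-cong (Func.cong G₁ {z} {w} z≈w) (ℂ′.-‿cong (Func.cong G₂ {z} {w} z≈w))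

    Δ-symmetry : ∀ {z} → z ∈ ℂ∖[ 0# ,∞⟩ →
      Δ (z +ᶜ 1ℂ) ≈ᶜ (-ᶜ (z ²) ⁻¹ᶜ *ᶜ Δ (z ⁻¹ᶜ +ᶜ 1ℂ))
    Δ-symmetry {z} z∈ =
      symmetry-difference {(z ²) ⁻¹ᶜ} {z ⁻¹ᶜ} (sym₁ {z} z∈) (sym₂ {z} z∈)

    -- The value at 1/(1 − z) is eliminated by the symmetry at 1/(1 − z) − 1, whose
    -- inverse is 1/z − 1.
    Δ-recurrence : ∀ z → z ∈ ℂ∖[ 0# ,∞⟩ →
      (2ℂ *ᶜ Δ (z +ᶜ 1ℂ)) ≈ᶜ (Δ z -ᶜ (z ⁻¹ᶜ *ᶜ z ⁻¹ᶜ) *ᶜ Δ (z ⁻¹ᶜ))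
    Δ-recurrence z z∈ =
      eliminate {s} {t} {2ℂ} {Δ z} {Δ (z +ᶜ 1ℂ)} {Δ p} {Δ r} {r *ᶜ r}
        (three-term-difference {p} {s} (three₁ {z} z∈) (three₂ {z} z∈))
        (ℂ′.trans {Δ p} (Δ-cong p (y +ᶜ 1ℂ) p≈y+1)
          (ℂ′.trans {Δ (y +ᶜ 1ℂ)} (Δ-symmetry {y} y∈)
            (ℂ′.*-congˡ (Δ-cong (y ⁻¹ᶜ +ᶜ 1ℂ) r y⁻¹+1≈r))))
        (product-of-inverse-squares {z} {r} {p} {s} {t} zr≈1 ap≈1
          (⁻¹ᶜ-inverseʳ (*ᶜ-≉0 a≉0)) (⁻¹ᶜ-inverseʳ (*ᶜ-≉0 y≉0)))
      where
      a p r y s t : ℂ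
      a = 1ℂ -ᶜ z
      p = a ⁻¹ᶜ
      r = z ⁻¹ᶜ
      y = p -ᶜ 1ℂ
      s = (a ²) ⁻¹ᶜ
      t = (y ²) ⁻¹ᶜ

      *ᶜ-≉0 : ∀ {x} → ¬ (x ≈ᶜ 0ℂ) → ¬ ((x ²) ≈ᶜ 0ℂ)
      *ᶜ-≉0 {x} x≉0 = inverse⇒≉0 {x ²} {x ⁻¹ᶜ *ᶜ x ⁻¹ᶜ} (inverse-square {x} (⁻¹ᶜ-inverseʳ x≉0))

      zr≈1 : z *ᶜ r ≈ᶜ 1ℂ
      zr≈1 = ⁻¹ᶜ-inverseʳ (∈⇒≉0 {z} z∈)

      a≉0 : ¬ (a ≈ᶜ 0ℂ)
      a≉0 a≈0 = z∈ (1# , 0≤1 , ℂ′.trans {z} (1-[1-z] z)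
        (ℂ′.trans (ℂ′.+-congˡ (ℂ′.-‿cong a≈0)) 1-0≈1))
        where
        1-[1-z] : ∀ z → z ≈ᶜ (1ℂ -ᶜ (1ℂ -ᶜ z))
        1-[1-z] z = solve 1 (λ x → x := :1 :- (:1 :- x)) refl (re z) ,
                    solve 1 (λ x → x := :0 :- (:0 :- x)) refl (im z)
        1-0≈1 : (1ℂ -ᶜ 0ℂ) ≈ᶜ 1ℂ
        1-0≈1 = solve 0 (:1 :- :0 := :1) refl , solve 0 (:0 :- :0 := :0) refl

      ap≈1 : a *ᶜ p ≈ᶜ 1ℂ
      ap≈1 = ⁻¹ᶜ-inverseʳ a≉0

      [r-1]y≈1 : (r -ᶜ 1ℂ) *ᶜ y ≈ᶜ 1ℂ
      [r-1]y≈1 = [r-1]*[p-1]≈1 {z} {r} {p} zr≈1 ap≈1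

      y[r-1]≈1 : y *ᶜ (r -ᶜ 1ℂ) ≈ᶜ 1ℂ
      y[r-1]≈1 = ℂ′.trans (ℂ′.*-comm y (r -ᶜ 1ℂ)) [r-1]y≈1

      y≉0 : ¬ (y ≈ᶜ 0ℂ)
      y≉0 = inverse⇒≉0 {y} {r -ᶜ 1ℂ} y[r-1]≈1

      -- Off [0,∞), r = 1/z is in particular off [1,∞), so r - 1 is off [0,∞), and so is its inverse
      -- y.
      y∈ : y ∈ ℂ∖[ 0# ,∞⟩
      y∈ = ∈-inverse {r -ᶜ 1ℂ} {y} [r-1]y≈1
        (∈-‿-1 {r} (∖0⊆∖1 {r} (∈-inverse {z} {r} zr≈1 z∈)))

      p≈y+1 : p ≈ᶜ (y +ᶜ 1ℂ)
      p≈y+1 = ℂ′.trans (x≈y+[x-y] p 1ℂ) (ℂ′.+-comm 1ℂ y)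

      y⁻¹+1≈r : (y ⁻¹ᶜ +ᶜ 1ℂ) ≈ᶜ r
      y⁻¹+1≈r = ℂ′.trans
        (ℂ′.+-congʳ {1ℂ} (ℂ′.sym (inverse-unique {y} {r -ᶜ 1ℂ} y[r-1]≈1)))
        (ℂ′.trans (ℂ′.+-comm (r -ᶜ 1ℂ) 1ℂ) (ℂ′.sym (x≈y+[x-y] r 1ℂ)))

    ∣Δ∣² : ℂ → Carrier
    ∣Δ∣² z = ∣ Δ z ∣²

    Δ-bounded : ∃ λ B → ∀ w → re w ≤ 0# → ∣Δ∣² w ≤ B
    Δ-bounded =
      let (M₁ , bound₁) = bounded-on-left G₁ holo₁ vanishes₁
          (M₂ , bound₂) = bounded-on-left G₂ holo₂ vanishes₂
      in 2# * (M₁ + M₂) , λ w re≤0 → ≤.trans (∣∣²-‿- (G₁ ⟨$⟩ w) (G₂ ⟨$⟩ w))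
        (*-monoˡ-≤ (proj₁ 0<2) (+-mono-≤ (bound₁ w re≤0) (bound₂ w re≤0)))

    Δ-vanishes : VanishesOnLeft ∣Δ∣²
    Δ-vanishes {ε} 0<ε =
      let (K₁ , 0≤K₁ , small₁)    = vanishes-on-left {G₁} vanishes₁ 0<ε/4
          (K₂ , 0≤K₂ , small₂)    = vanishes-on-left {G₂} vanishes₂ 0<ε/4
          (K , K₁≤K , K₂≤K)       = common-upper-bound K₁ K₂
          0≤K                      = ≤.trans 0≤K₁ K₁≤K
      in K , 0≤K , λ w re≤0 K²≤ → begin
        ∣Δ∣² w                                      ≤⟨ ∣∣²-‿- (G₁ ⟨$⟩ w) (G₂ ⟨$⟩ w) ⟩
        2# * (∣ G₁ ⟨$⟩ w ∣² + ∣ G₂ ⟨$⟩ w ∣²)       ≤⟨ *-monoˡ-≤ (proj₁ 0<2) (+-mono-≤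
          (small₁ w re≤0 (≤.trans (*-mono-≤ 0≤K 0≤K₁ K₁≤K K₁≤K) K²≤))
          (small₂ w re≤0 (≤.trans (*-mono-≤ 0≤K 0≤K₂ K₂≤K K₂≤K) K²≤))) ⟩
        2# * (half (half ε) + half (half ε))        ≈⟨ *-congˡ (half+half (half ε)) ⟩
        2# * half ε                                 ≈⟨ solve 1 (λ h → :2 :* h := h :+ h) refl (half ε) ⟩
        half ε + half ε                             ≈⟨ half+half ε ⟩
        ε                                           ∎
      where
      -- A quarter, since 2(ε/4 + ε/4) = ε in the bound for a squared difference.
      0<ε/4 : 0# < half (half ε)
      0<ε/4 = half-positive (half-positive 0<ε)

    Δ-average : ∀ w → re w ≤ 0# →
      ∃ λ u → ∃ λ v → re u ≤ re w - 1# × re v ≤ 0# × ∣Δ∣² w + ∣Δ∣² w ≤ ∣Δ∣² u + ∣Δ∣² v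
    Δ-average w re≤0 = z , r , ≤.refl , re-⁻¹≤0 {z} z≉0 re-z≤0 , *-cancelˡ-≤ 0<2 (begin
      2# * (∣Δ∣² w + ∣Δ∣² w)             ≈⟨ *-congˡ (solve 1 (λ x → x :+ x := :2 :* x) refl (∣Δ∣² w)) ⟩
      2# * (2# * ∣Δ∣² w)                 ≈⟨ ∣2z∣² (Δ w) ⟨
      ∣ 2ℂ *ᶜ Δ w ∣²                     ≈⟨ ∣∣²-cong {2ℂ *ᶜ Δ w} {Δ z -ᶜ (r *ᶜ r) *ᶜ Δ r} 2Δw≈ ⟩
      ∣ Δ z -ᶜ (r *ᶜ r) *ᶜ Δ r ∣²        ≤⟨ ∣∣²-‿- (Δ z) ((r *ᶜ r) *ᶜ Δ r) ⟩
      2# * (∣Δ∣² z + ∣ (r *ᶜ r) *ᶜ Δ r ∣²) ≤⟨ *-monoˡ-≤ (proj₁ 0<2) (+-mono-≤ ≤.refl contraction) ⟩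
      2# * (∣Δ∣² z + ∣Δ∣² r)             ∎)
      where
      z r : ℂ
      z = w -ᶜ 1ℂ
      r = z ⁻¹ᶜ

      re-z≤-1 : re z ≤ - 1#
      re-z≤-1 = ≤-certificate (x≤y⇒0≤y-x re≤0)
        (solve 1 (λ a → :0 :- a := (:- :1) :- (a :- :1)) refl (re w))

      -1≤0 : - 1# ≤ 0#
      -1≤0 = ≤-certificate 0≤1 (solve 0 (:1 := :0 :- (:- :1)) refl)

      re-z≤0 : re z ≤ 0#
      re-z≤0 = ≤.trans re-z≤-1 -1≤0

      z∈ : z ∈ ℂ∖[ 0# ,∞⟩
      z∈ = ∈-‿-1 {w} (re≤0⇒∈ {w} re≤0)

      z≉0 : ¬ (z ≈ᶜ 0ℂ)
      z≉0 = ∈⇒≉0 {z} z∈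

      2Δw≈ : (2ℂ *ᶜ Δ w) ≈ᶜ (Δ z -ᶜ (r *ᶜ r) *ᶜ Δ r)
      2Δw≈ = ℂ′.trans (ℂ′.*-congˡ {2ℂ} (Δ-cong w (z +ᶜ 1ℂ)
        (ℂ′.trans (x≈y+[x-y] w 1ℂ) (ℂ′.+-comm 1ℂ z)))) (Δ-recurrence z z∈)

      ∣r∣²≤1 : ∣ r ∣² ≤ 1#
      ∣r∣²≤1 = ∣⁻¹∣²≤1 {z} z≉0 (≤.trans (≤.reflexive (sym (*-identityˡ 1#)))
        (x≤-y≤0⇒y²≤s 0≤1 re-z≤-1 (re²≤∣∣² z)))

      contraction : ∣ (r *ᶜ r) *ᶜ Δ r ∣² ≤ ∣Δ∣² r
      contraction = begin
        ∣ (r *ᶜ r) *ᶜ Δ r ∣²       ≈⟨ ∣∣²-* (r *ᶜ r) (Δ r) ⟩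
        ∣ r *ᶜ r ∣² * ∣Δ∣² r       ≈⟨ *-congʳ (∣∣²-* r r) ⟩
        ∣ r ∣² * ∣ r ∣² * ∣Δ∣² r   ≤⟨ *-mono-≤ (*-nonNegative 0≤1 0≤1) 0≤∣ Δ r ∣²
                                      (*-mono-≤ 0≤1 0≤∣ r ∣² ∣r∣²≤1 ∣r∣²≤1) ≤.refl ⟩
        1# * 1# * ∣Δ∣² r           ≈⟨ solve 1 (λ x → :1 :* :1 :* x := x) refl (∣Δ∣² r) ⟩
        ∣Δ∣² r                     ∎

    Δ≈0-on-left : ∀ w → re w ≤ 0# → Δ w ≈ᶜ 0ℂ
    Δ≈0-on-left w re≤0 =
      ∣z∣²≤0⇒z≈0 {Δ w} (no-positive-maximum ∣Δ∣² Δ-bounded Δ-vanishes Δ-average w re≤0)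

    -- Descent from the points where Δ does not vanish

    -- The shift by 1 lets v range over the domain of the recurrence while v + 1 ranges over that of
    -- Δ.
    Support : ℂ → Set
    Support v = v ∈ ℂ∖[ 0# ,∞⟩ × ¬ (Δ (v +ᶜ 1ℂ) ≈ᶜ 0ℂ)

    Δ[v]-Δ[v⁻¹]-not-both-0 : ∀ {v} → Support v → ¬ (Δ v ≈ᶜ 0ℂ × Δ (v ⁻¹ᶜ) ≈ᶜ 0ℂ)
    Δ[v]-Δ[v⁻¹]-not-both-0 {v} (v∈ , Δ≉0) (Δv≈0 , Δr≈0) = Δ≉0 (2ℂ-cancel {Δ (v +ᶜ 1ℂ)}
      (ℂ′.trans (Δ-recurrence v v∈)
        (ℂ′.trans (ℂ′.+-cong Δv≈0 (ℂ′.-‿cong (ℂ′.*-congˡ {v ⁻¹ᶜ *ᶜ v ⁻¹ᶜ} Δr≈0)))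
          (0-x*0≈0 (v ⁻¹ᶜ *ᶜ v ⁻¹ᶜ)))))

    -- If re v ≤ 0, then v and 1/v both lie where Δ is already known to vanish, and the recurrence
    -- gives Δ(v + 1) = 0.
    support-re : ∀ {v} → Support v → 0# < re v
    support-re {v} v∈S@(v∈ , _) = ≰⇒> λ re≤0 → Δ[v]-Δ[v⁻¹]-not-both-0 {v} v∈S
      ( Δ≈0-on-left v re≤0
      , Δ≈0-on-left (v ⁻¹ᶜ) (re-⁻¹≤0 {v} (∈⇒≉0 {v} v∈) re≤0))

    support-‿-1 : ∀ {v} → v ∈ ℂ∖[ 1# ,∞⟩ → ¬ (Δ v ≈ᶜ 0ℂ) → Support (v -ᶜ 1ℂ)
    support-‿-1 {v} v∈ Δv≉0 = ∈-‿-1 {v} v∈ , λ Δ≈0 → Δv≉0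
      (ℂ′.trans (Δ-cong v ((v -ᶜ 1ℂ) +ᶜ 1ℂ)
        (ℂ′.trans (x≈y+[x-y] v 1ℂ) (ℂ′.+-comm 1ℂ (v -ᶜ 1ℂ)))) Δ≈0)

    support-⁻¹ : ∀ {v} → Support v → v ⁻¹ᶜ ∈ ℂ∖[ 0# ,∞⟩
    support-⁻¹ {v} (v∈ , _) = ∈-inverse {v} {v ⁻¹ᶜ} (⁻¹ᶜ-inverseʳ (∈⇒≉0 {v} v∈)) v∈

    support-step : ∀ {v} → Support v → Support (v -ᶜ 1ℂ) ⊎ Support (v ⁻¹ᶜ -ᶜ 1ℂ)
    support-step {v} v∈S = by-cases em em
      where
      by-cases : Dec (Δ v ≈ᶜ 0ℂ) → Dec (Δ (v ⁻¹ᶜ) ≈ᶜ 0ℂ) → Support (v -ᶜ 1ℂ) ⊎ Support (v ⁻¹ᶜ -ᶜ 1ℂ)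
      by-cases (no Δv≉0) _           = inj₁ (support-‿-1 {v} (∖0⊆∖1 {v} (proj₁ v∈S)) Δv≉0)
      by-cases (yes _)   (no Δr≉0)   = inj₂ (support-‿-1 {v ⁻¹ᶜ} (∖0⊆∖1 {v ⁻¹ᶜ} (support-⁻¹ {v} v∈S)) Δr≉0)
      by-cases (yes Δv≈0) (yes Δr≈0) = ⊥-elim (Δ[v]-Δ[v⁻¹]-not-both-0 {v} v∈S (Δv≈0 , Δr≈0))

    G₁≈G₂ : ∀ z → z ∈ ℂ∖[ 1# ,∞⟩ → (G₁ ⟨$⟩ z) ≈ᶜ (G₂ ⟨$⟩ z)
    G₁≈G₂ z z∈ = by-cases em
      where
      by-cases : Dec (Δ z ≈ᶜ 0ℂ) → (G₁ ⟨$⟩ z) ≈ᶜ (G₂ ⟨$⟩ z)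
      by-cases (yes Δ≈0) = x-y≈0⇒x≈y Δ≈0
      by-cases (no Δ≉0)  = ⊥-elim (EuclideanAlgorithm.empty Support proj₁
        (λ {v} → support-re {v}) (λ {v} → support-step {v}) (support-‿-1 {z} z∈ Δ≉0))

proposition4 : ExcludedMiddle 0ℓ →
    (ℝ : CompleteOrderedField) →
    let open CompleteOrderedField ℝ using (1#)
        open ComplexNumbers ℝ
    in
    (G₁ G₂ : ComplexFunction) →
    HolomorphicOn ℂ∖[ 1# ,∞⟩ G₁ → HolomorphicOn ℂ∖[ 1# ,∞⟩ G₂ →
    ThreeTermEquation G₁ → ThreeTermEquation G₂ →
    SymmetryEquation G₁ → SymmetryEquation G₂ →
    VanishesFarFromℝ₊ G₁ → VanishesFarFromℝ₊ G₂ →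
    ∀ z → z ∈ ℂ∖[ 1# ,∞⟩ → (G₁ ⟨$⟩ z) ≈ (G₂ ⟨$⟩ z)
proposition4 em ℝ G₁ G₂ holo₁ holo₂ three₁ three₂ sym₁ sym₂ vanishes₁ vanishes₂ =
  Uniqueness.G₁≈G₂ em ℝ G₁ G₂ holo₁ holo₂ three₁ three₂ sym₁ sym₂ vanishes₁ vanishes₂
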